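{- For any $p>0$ and $\epsilon\in(0,0.9)$, any one-pass $(1+\epsilon,0.49)$-$L_{M_p}$-sampler (in the node-arrival streaming model) on a data stream of length $n$ needs $\Omega(n)$ bits of space.
   Context: Similarity graph. $U$ is a universe of items and $f:U\times U\to[0,1]$ is a symmetric similarity function with $f(x,x)=1$ for all $x\in U$. For a stream $\sigma=(\sigma_1,\dots,\sigma_n)\in U^n$, the degree of node $i\in[n]$ in the similarity graph $G^\sigma$ (complete graph on $[n]$ with self-loops, weights $w(i,j)=f(\sigma_i,\sigma_j)$) is $d_i=\sum_{j\in[n]} f(\sigma_i,\sigma_j)$, and $M_p(\sigma)=\sum_{i\in[n]} d_i^p$. Each stream position is a distinct node; node $i$ is represented by the pair $(i,\sigma_i)$. Sampler. A $(1+\epsilon,\delta)$-$L_{M_p}$-sampler on $G^\sigma$ fails with probability at most $\delta$ and, conditioned on no failure, outputs node $i$ with a probability $p_i$ satisfying $(1-\epsilon)\frac{d_i^{p}}{M_p(\sigma)}\le p_i\le(1+\epsilon)\frac{d_i^{p}}{M_p(\sigma)}$, for every $i\in[n]$. Node-arrival streaming model. The items $\sigma_1,\dots,\sigma_n$ arrive sequentially and the algorithm, which has access to $f$, makes one or more linear scans (passes) over them while maintaining a bounded memory state. Algorithms are randomized; the algorithm's guarantee is required for every universe $U$, every similarity function $f$ and every stream $\sigma$ of length $n$, and its space is the worst-case number of bits of memory. Throughout, $p$ is a constant; the constant hidden in $\Omega(\cdot)$ may depend on $p$. -}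

module Defs where

open import Data.Bool.Base using (Bool; if_then_else_)
open import Data.Fin.Base using (Fin)
import Data.Fin.Properties as Fin
open import Data.Integer.Base using (+_)
import Data.Integer.Base as ℤ
open import Data.List.Base using (List; []; _∷_; tabulate)
open import Data.Maybe.Base using (Maybe; just; nothing)
import Data.Maybe.Properties as Maybe
open import Data.Nat.Base using (ℕ; zero; suc)
import Data.Nat.Base as ℕ
open import Data.Product.Base using (_×_; _,_; ∃-syntax)
import Data.Product.Properties as Product
open import Data.Rational.Base
  using (ℚ; 0ℚ; 1ℚ; _+_; _-_; _*_; _÷_; _/_; _≤_; _≤ᵇ_; ∣_∣; ↥_; ↧ₙ_; ≢-nonZero; +-*-rawSemiring)
open import Data.Rational.Properties using (_≟_)
open import Data.Vec.Base using (Vec)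
open import Data.Vec.Functional using (Vector)
open import Relation.Binary.Definitions using (DecidableEquality)
open import Relation.Nullary.Decidable using (yes; no; ⌊_⌋)

open import Algebra.Definitions.RawSemiring +-*-rawSemiring using (sum; _^_)

-- Real numbers are Cauchy sequences of rationals.  Arithmetic is performed
-- termwise on representing sequences, and (in)equalities compare limits.

Seq : Set
Seq = ℕ → ℚ

1/suc : ℕ → ℚ
1/suc k = + 1 / suc k

record ℝ : Set where
  field
    seq    : Seq
    cauchy : ∀ k → ∃[ N ] (∀ m m′ → N ℕ.≤ m → N ℕ.≤ m′ → ∣ seq m - seq m′ ∣ ≤ 1/suc k)

open ℝ public

const : ℚ → Seq
const q _ = q

infix 4 _≤ᴿ_ _<ᴿ_ _≈ᴿ_

_≤ᴿ_ : Seq → Seq → Set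
x ≤ᴿ y = ∀ k → ∃[ N ] (∀ m → N ℕ.≤ m → x m ≤ y m + 1/suc k)

_<ᴿ_ : Seq → Seq → Set
x <ᴿ y = ∃[ k ] ∃[ N ] (∀ m → N ℕ.≤ m → x m + 1/suc k ≤ y m)

_≈ᴿ_ : Seq → Seq → Set
x ≈ᴿ y = x ≤ᴿ y × y ≤ᴿ x

infixl 6 _+ᴿ_ _-ᴿ_
infixl 7 _*ᴿ_ _÷ᴿ_
infixr 8 _^ᴿ_

_+ᴿ_ _-ᴿ_ _*ᴿ_ : Seq → Seq → Seq
(x +ᴿ y) m = x m + y m
(x -ᴿ y) m = x m - y m
(x *ᴿ y) m = x m * y m

-- Termwise division; the value at a zero denominator is irrelevant to the limit
-- when y converges to a nonzero number.
_÷ᴿ_ : Seq → Seq → Seq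
(x ÷ᴿ y) m with y m ≟ 0ℚ
... | yes _   = 0ℚ
... | no ym≢0 = _÷_ (x m) (y m) {{≢-nonZero ym≢0}}

∑ : ∀ {k} → Vector Seq k → Seq
∑ x m = sum (λ i → x i m)

greatest : (ℕ → Bool) → ℕ → ℕ
greatest P zero    = 0
greatest P (suc b) = if P (suc b) then suc b else greatest P b

-- For x > 0 and q = a / b ≥ 0: the largest multiple j / N of 1 / N with
-- (j / N) ^ b ≤ x ^ a, so that x ^ (a / b) - 1 / N < j / N ≤ x ^ (a / b).
-- Any such j is at most N * (1 + |numerator of x|) ^ a.
rationalPower : ℚ → ℚ → (N : ℕ) → .{{ℕ.NonZero N}} → ℚ
rationalPower x q N = + greatest below bound / N
  where
  a b bound : ℕ
  a = ℤ.∣ ↥ q ∣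
  b = ↧ₙ q
  bound = N ℕ.* (1 ℕ.+ ℤ.∣ ↥ x ∣) ℕ.^ a

  below : ℕ → Bool
  below j = (+ j / N) ^ b ≤ᵇ x ^ a

-- Real power as the limit of rational powers of rational numbers, for base
-- and exponent with positive limits.
_^ᴿ_ : Seq → Seq → Seq
(x ^ᴿ p) m = rationalPower (x m) (p m) (suc m)

-- Finitely supported probability distributions with real weights.
record Dist (A : Set) : Set where
  field
    size   : ℕ
    point  : Fin size → A
    weight : Fin size → ℝ
    nonneg : ∀ i → const 0ℚ ≤ᴿ seq (weight i)
    total  : ∑ (λ i → seq (weight i)) ≈ᴿ const 1ℚ

𝔼 : ∀ {A} → Dist A → (A → Seq) → Seq
𝔼 μ g = ∑ (λ i → seq (weight i) *ᴿ g (point i))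
  where open Dist μ

-- A universe of u items is Fin u.  (Memory of finitely many bits cannot hold
-- even a single item of an infinite universe.)
record Similarity (u : ℕ) : Set where
  field
    f         : Fin u → Fin u → ℝ
    nonneg    : ∀ x y → const 0ℚ ≤ᴿ seq (f x y)
    atMostOne : ∀ x y → seq (f x y) ≤ᴿ const 1ℚ
    symmetric : ∀ x y → seq (f x y) ≈ᴿ seq (f y x)
    self      : ∀ x → seq (f x x) ≈ᴿ const 1ℚ

Stream : ℕ → ℕ → Set
Stream n u = Vector (Fin u) n

-- Node i of the similarity graph of σ is represented by the pair (i , σ i).
Node : ℕ → ℕ → Set
Node n u = Fin n × Fin u

module _ {n u} (F : Similarity u) (σ : Stream n u) where
  open Similarity F

  degree : Fin n → Seq
  degree i = ∑ (λ j → seq (f (σ i) (σ j)))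

  moment : Seq → Seq
  moment p = ∑ (λ i → degree i ^ᴿ p)

-- A randomized one-pass machine with s bits of memory.  It tosses fresh coins
-- at every step; coins are remembered only through the memory state.
-- The output `nothing` means failure.
record Machine (n u s : ℕ) : Set where
  State : Set
  State = Vec Bool s
  field
    init   : Dist State
    step   : Node n u → State → Dist State
    output : State → Dist (Maybe (Node n u))

module _ {n u s} (M : Machine n u s) where
  open Machine M

  𝔼-scan : List (Node n u) → (State → Seq) → State → Seq
  𝔼-scan []       g t = g t
  𝔼-scan (v ∷ vs) g t = 𝔼 (step v t) (𝔼-scan vs g)

  _≟ₒ_ : DecidableEquality (Maybe (Node n u))
  _≟ₒ_ = Maybe.≡-dec (Product.≡-dec Fin._≟_ Fin._≟_)

  Pr[_outputs_] : Stream n u → Maybe (Node n u) → Seq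
  Pr[_outputs_] σ o = 𝔼 init (𝔼-scan (tabulate (λ i → i , σ i)) final)
    where
    final : State → Seq
    final t = 𝔼 (output t) (λ o′ → const (if ⌊ o′ ≟ₒ o ⌋ then 1ℚ else 0ℚ))

-- An algorithm has access to the similarity function, and its memory may
-- depend on the universe: log₂ u bits are needed just to name an item, so a bound
-- on the worst-case space is only meaningful when u is bounded in terms of n.
record OnePassAlgorithm (n : ℕ) : Set where
  field
    space   : ∀ {u} → Similarity u → ℕ
    machine : ∀ {u} (F : Similarity u) → Machine n u (space F)

module _ {n u} (A : OnePassAlgorithm n) (F : Similarity u) (σ : Stream n u) where
  open OnePassAlgorithm A

  failure : Seq
  failure = Pr[_outputs_] (machine F) σ nothing

  hit : Fin n → Seq
  hit i = Pr[_outputs_] (machine F) σ (just (i , σ i))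

  -- Probability of outputting node i, conditioned on no failure.
  conditional : Fin n → Seq
  conditional i = hit i ÷ᴿ (const 1ℚ -ᴿ failure)

target : ∀ {n u} → Seq → Similarity u → Stream n u → Fin n → Seq
target p F σ i = (degree F σ i ^ᴿ p) ÷ᴿ moment F σ p

-- (1+ε,δ)-L_{M_p}-sampler.  The second condition says that unless it fails,
-- the algorithm outputs a node of the similarity graph.
IsSampler : ∀ {n} (ε δ p : Seq) → OnePassAlgorithm n → Set
IsSampler {n} ε δ p A = ∀ {u} (F : Similarity u) (σ : Stream n u) →
  failure A F σ ≤ᴿ δ ×
  failure A F σ +ᴿ ∑ (hit A F σ) ≈ᴿ const 1ℚ ×
  (∀ i → (const 1ℚ -ᴿ ε) *ᴿ target p F σ i ≤ᴿ conditional A F σ i ×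
         conditional A F σ i ≤ᴿ (const 1ℚ +ᴿ ε) *ᴿ target p F σ i)

{-# OPTIONS --safe #-}
module Submission where

-- The memory after a prefix of the stream must allow every bit of a long
-- string x to be recovered by a suitable continuation.
--
-- The prefix has k blocks of r nodes; all nodes are pairwise dissimilar.  The
-- continuation for the bit j consists of m nodes which are similar to the nodes
-- of block j if x j = 1, and to nothing otherwise.  In the latter case all
-- degrees are 1, so the m + r nodes of the continuation and of block j are
-- rarely sampled, since m + r is much smaller than n.  In the former case the
-- continuation has degrees above r, so M_p ≥ m r ^ p, and the other nodes, still
-- of degree 1, are rarely sampled as soon as r ^ p is much larger than n / m,
-- which is achieved by a constant r depending on p.  So whether the sampled node
-- is one of these m + r nodes reveals x j: a wrong answer has probability at
-- most 1 / 200, a right one at least 101 / 200.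
--
-- For a fixed memory state, let each j vote for 0, 1 or abstain according to the
-- difference of the probabilities of both answers.  On average over the memory,
-- x gets many more right than wrong votes, so some state does this for x; but
-- a fixed state does this only for an exponentially small fraction of all x.
--
-- All inequalities between limits are handled termwise.  In particular the votes
-- need not converge: they are read off at one sufficiently late index.

open import Defs
open import Algebra.Bundles using (CommutativeRing)
open import Data.Bool.Base using (Bool; true; false; not; if_then_else_; _∧_; _∨_; _xor_)
import Data.Bool.Properties as Bool
open import Data.Empty using (⊥; ⊥-elim)
open import Data.Fin.Base using (Fin; zero; suc; _↑ˡ_; _↑ʳ_; splitAt; combine; remQuot; quotient)
import Data.Fin.Properties as Fin
open import Data.Integer.Base as ℤ using (+_; +[1+_]; -[1+_])
import Data.Integer.Properties as ℤ
open import Data.List.Base using (List; []; _∷_; _++_; tabulate)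
import Data.List.Properties as List
open import Data.Maybe.Base using (Maybe; just; nothing)
open import Data.Nat.Base as ℕ using (ℕ; zero; suc; NonZero; _≥_; _^_) renaming (_≤_ to _≤ℕ_)
import Data.Nat.DivMod as ℕ
import Data.Nat.Properties as ℕ
open import Data.Nat.Solver using () renaming (module +-*-Solver to ℕ-Solver)
open import Data.Product.Base using (_×_; _,_; proj₁; proj₂; ∃-syntax; Σ-syntax)
open import Data.Rational.Base
  using (ℚ; mkℚ; 0ℚ; 1ℚ; ½; _+_; _-_; _*_; -_; _/_; _≤_; _<_; _≤ᵇ_; *≤*; *<*; ∣_∣; ↥_; ↧ₙ_; toℚᵘ;
         +-*-rawSemiring; nonNegative; positive; ≢-nonZero)
open import Data.Rational.Properties as ℚ using (module ≤-Reasoning)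
open import Data.Rational.Solver using (module +-*-Solver)
open import Data.Rational.Unnormalised.Base as ℚᵘ using (mkℚᵘ)
import Data.Rational.Unnormalised.Properties as ℚᵘ
open import Data.Sum.Base using (_⊎_; inj₁; inj₂; [_,_]′)
open import Data.Vec.Base using (Vec; []; _∷_; lookup)
open import Function.Base using (_∘_)
open import Function.Bundles using (Equivalence)
open import Relation.Binary.PropositionalEquality
open import Relation.Nullary.Decidable using (yes; no; ⌊_⌋)

open import Algebra.Definitions.RawSemiring +-*-rawSemiring using (sum) renaming (_^_ to _^ℚ_)
import Algebra.Properties.CommutativeMonoid.Sum ℕ.*-1-commutativeMonoid as ℕ∏
import Algebra.Properties.Semiring.Sum ℕ.+-*-semiring as ℕΣ
import Algebra.Properties.Semiring.Sum (CommutativeRing.semiring ℚ.+-*-commutativeRing) as Sum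

-- Counting bit strings against memory states

module _ where
  open ℕ-Solver

  sumBits : ∀ {n} → (Vec Bool n → ℕ) → ℕ
  sumBits {zero}  f = f []
  sumBits {suc n} f = sumBits (f ∘ (true ∷_)) ℕ.+ sumBits (f ∘ (false ∷_))

  sumBits-mono : ∀ {n} {f g : Vec Bool n → ℕ} → (∀ x → f x ℕ.≤ g x) → sumBits f ℕ.≤ sumBits g
  sumBits-mono {zero}  f≤g = f≤g []
  sumBits-mono {suc n} f≤g = ℕ.+-mono-≤ (sumBits-mono (f≤g ∘ (true ∷_))) (sumBits-mono (f≤g ∘ (false ∷_)))

  sumBits-const : ∀ n c → sumBits {n} (λ _ → c) ≡ 2 ℕ.^ n ℕ.* c
  sumBits-const zero    c = sym (ℕ.+-identityʳ c)
  sumBits-const (suc n) c rewrite sumBits-const n c = solve 2 (λ a c → a :* c :+ a :* c := (con 2 :* a) :* c) refl (2 ℕ.^ n) c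

  sumBits-+ : ∀ {n} (f g : Vec Bool n → ℕ) → sumBits (λ x → f x ℕ.+ g x) ≡ sumBits f ℕ.+ sumBits g
  sumBits-+ {zero}  f g = refl
  sumBits-+ {suc n} f g rewrite sumBits-+ (f ∘ (true ∷_)) (g ∘ (true ∷_)) | sumBits-+ (f ∘ (false ∷_)) (g ∘ (false ∷_)) =
    solve 4 (λ a b c d → a :+ b :+ (c :+ d) := a :+ c :+ (b :+ d)) refl
      (sumBits (f ∘ (true ∷_))) (sumBits (g ∘ (true ∷_))) (sumBits (f ∘ (false ∷_))) (sumBits (g ∘ (false ∷_)))

  sumBits-* : ∀ {n} c (f : Vec Bool n → ℕ) → sumBits (λ x → c ℕ.* f x) ≡ c ℕ.* sumBits f
  sumBits-* {zero}  c f = refl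
  sumBits-* {suc n} c f rewrite sumBits-* c (f ∘ (true ∷_)) | sumBits-* c (f ∘ (false ∷_)) =
    sym (ℕ.*-distribˡ-+ c (sumBits (f ∘ (true ∷_))) (sumBits (f ∘ (false ∷_))))

  sumBits-comm : ∀ {n s} (f : Vec Bool n → Vec Bool s → ℕ) →
    sumBits (λ x → sumBits (f x)) ≡ sumBits (λ t → sumBits (λ x → f x t))
  sumBits-comm {zero}  f = refl
  sumBits-comm {suc n} f = trans
    (cong₂ ℕ._+_ (sumBits-comm (f ∘ (true ∷_))) (sumBits-comm (f ∘ (false ∷_))))
    (sym (sumBits-+ (λ t → sumBits (λ x → f (true ∷ x) t)) (λ t → sumBits (λ x → f (false ∷ x) t))))

  ≤sumBits : ∀ {n} (f : Vec Bool n → ℕ) t → f t ℕ.≤ sumBits f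
  ≤sumBits f []          = ℕ.≤-refl
  ≤sumBits f (true  ∷ t) = ℕ.≤-trans (≤sumBits (f ∘ (true ∷_)) t) (ℕ.m≤m+n _ _)
  ≤sumBits f (false ∷ t) = ℕ.≤-trans (≤sumBits (f ∘ (false ∷_)) t) (ℕ.m≤n+m _ _)

  product : ∀ {n} → (Fin n → ℕ) → ℕ
  product = ℕ∏.sum

  -- By distributivity the sum over all strings is the product over the coordinates of the sums over
  -- one bit, each of which is `c`.
  sumBits-product : ∀ {n c} (w : Fin n → Bool → ℕ) → (∀ j → w j true ℕ.+ w j false ≡ c) →
    sumBits (λ x → product (λ j → w j (lookup x j))) ≡ c ℕ.^ n
  sumBits-product {zero}  w eq = refl
  sumBits-product {suc n} {c} w eq = begin
    sumBits (λ x → w zero true ℕ.* rest x) ℕ.+ sumBits (λ x → w zero false ℕ.* rest x)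
      ≡⟨ cong₂ ℕ._+_ (sumBits-* (w zero true) rest) (sumBits-* (w zero false) rest) ⟩
    w zero true ℕ.* sumBits rest ℕ.+ w zero false ℕ.* sumBits rest
      ≡⟨ ℕ.*-distribʳ-+ (sumBits rest) (w zero true) (w zero false) ⟨
    (w zero true ℕ.+ w zero false) ℕ.* sumBits rest
      ≡⟨ cong₂ ℕ._*_ (eq zero) (sumBits-product (w ∘ suc) (eq ∘ suc)) ⟩
    c ℕ.* c ℕ.^ n ∎
    where
    open ≡-Reasoning
    rest : Vec Bool n → ℕ
    rest x = product (λ j → w (suc j) (lookup x j))

  -- A vote (nothing is an abstention) against the actual bit.  The potentials
  -- 3, 2, 1 sum to 4 over both bits, and the scores 3, 2, 0 are rounded-down
  -- logarithms of their squares.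
  score potential : Maybe Bool → Bool → ℕ

  score (just true)  true  = 3
  score (just false) false = 3
  score (just true)  false = 0
  score (just false) true  = 0
  score nothing      _     = 2

  potential (just true)  true  = 3
  potential (just false) false = 3
  potential (just true)  false = 1
  potential (just false) true  = 1
  potential nothing      _     = 2

  score≤3 : ∀ v c → score v c ℕ.≤ 3
  score≤3 (just true)  true  = ℕ.≤-refl
  score≤3 (just false) false = ℕ.≤-refl
  score≤3 (just true)  false = ℕ.z≤n
  score≤3 (just false) true  = ℕ.z≤n
  score≤3 nothing      _     = ℕ.n≤1+n 2

  potential-total : ∀ v → potential v true ℕ.+ potential v false ≡ 4
  potential-total (just true)  = refl
  potential-total (just false) = refl
  potential-total nothing      = refl

  2^score≤potential² : ∀ v c → 2 ℕ.^ score v c ℕ.≤ potential v c ℕ.* potential v c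
  2^score≤potential² (just true)  true  = ℕ.n≤1+n 8
  2^score≤potential² (just false) false = ℕ.n≤1+n 8
  2^score≤potential² (just true)  false = ℕ.≤-refl
  2^score≤potential² (just false) true  = ℕ.≤-refl
  2^score≤potential² nothing      _     = ℕ.≤-refl

  2^sum≤product² : ∀ {n} (a b : Fin n → ℕ) → (∀ j → 2 ℕ.^ a j ℕ.≤ b j ℕ.* b j) →
    2 ℕ.^ ℕΣ.sum a ℕ.≤ product b ℕ.* product b
  2^sum≤product² {zero}  a b h = ℕ.≤-refl
  2^sum≤product² {suc n} a b h = begin
    2 ℕ.^ (a zero ℕ.+ ℕΣ.sum (a ∘ suc))       ≡⟨ ℕ.^-distribˡ-+-* 2 (a zero) _ ⟩
    2 ℕ.^ a zero ℕ.* 2 ℕ.^ ℕΣ.sum (a ∘ suc)   ≤⟨ ℕ.*-mono-≤ (h zero) (2^sum≤product² (a ∘ suc) (b ∘ suc) (h ∘ suc)) ⟩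
    (b zero ℕ.* b zero) ℕ.* (product (b ∘ suc) ℕ.* product (b ∘ suc))
      ≡⟨ solve 2 (λ x y → (x :* x) :* (y :* y) := (x :* y) :* (x :* y)) refl (b zero) (product (b ∘ suc)) ⟩
    product b ℕ.* product b   ∎
    where open ℕ.≤-Reasoning

  square-cancel-≤ : ∀ {a b} → a ℕ.* a ℕ.≤ b ℕ.* b → a ℕ.≤ b
  square-cancel-≤ {a} {b} le = ℕ.≮⇒≥ λ b<a → ℕ.<⇒≱ (ℕ.*-mono-< b<a b<a) le

  2^-cancel-≤ : ∀ {a b} → 2 ℕ.^ a ℕ.≤ 2 ℕ.^ b → a ℕ.≤ b
  2^-cancel-≤ {a} {b} le = ℕ.≮⇒≥ λ b<a → ℕ.<⇒≱ (ℕ.^-monoʳ-< 2 (ℕ.s≤s (ℕ.s≤s ℕ.z≤n)) b<a) le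

  -- Averaged over all x, the product of the potentials of a fixed memory state is
  -- 2 ^ (10 κ), whereas every x has a state for which it is at least 2 ^ (11 κ).
  few-states : ∀ {s} κ (vote : Vec Bool s → Fin (10 ℕ.* κ) → Maybe Bool) (state : Vec Bool (10 ℕ.* κ) → Vec Bool s) →
    (∀ x → 22 ℕ.* κ ℕ.≤ ℕΣ.sum (λ j → score (vote (state x) j) (lookup x j))) → κ ℕ.≤ s
  -- The count is 2 ^ k * 2 ^ (11 κ) ≤ 2 ^ s * 4 ^ k; with k = 10 κ the exponents are 21 κ and s +
  -- 20 κ.
  few-states {s} κ vote state h = ℕ.+-cancelʳ-≤ (20 ℕ.* κ) κ s (2^-cancel-≤ (begin
    2 ℕ.^ (κ ℕ.+ 20 ℕ.* κ)                  ≡⟨ cong (2 ℕ.^_) (solve 1 (λ κ → κ :+ con 20 :* κ := con 10 :* κ :+ con 11 :* κ) refl κ) ⟩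
    2 ℕ.^ (k ℕ.+ 11 ℕ.* κ)                  ≡⟨ ℕ.^-distribˡ-+-* 2 k (11 ℕ.* κ) ⟩
    2 ℕ.^ k ℕ.* 2 ℕ.^ (11 ℕ.* κ)            ≡⟨ sumBits-const k (2 ℕ.^ (11 ℕ.* κ)) ⟨
    sumBits {k} (λ _ → 2 ℕ.^ (11 ℕ.* κ))    ≤⟨ sumBits-mono heavy ⟩
    sumBits (λ x → W x (state x))           ≤⟨ sumBits-mono (λ x → ≤sumBits (W x) (state x)) ⟩
    sumBits (λ x → sumBits (W x))           ≡⟨ sumBits-comm W ⟩
    sumBits (λ t → sumBits (λ x → W x t))   ≤⟨ sumBits-mono (λ t → ℕ.≤-reflexive (sumBits-product (λ j → potential (vote t j)) (λ j → potential-total (vote t j)))) ⟩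
    sumBits {s} (λ t → 4 ℕ.^ k)             ≡⟨ sumBits-const s (4 ℕ.^ k) ⟩
    2 ℕ.^ s ℕ.* 4 ℕ.^ k                     ≡⟨ cong (2 ℕ.^ s ℕ.*_) (ℕ.^-*-assoc 2 2 k) ⟩
    2 ℕ.^ s ℕ.* 2 ℕ.^ (2 ℕ.* k)             ≡⟨ ℕ.^-distribˡ-+-* 2 s (2 ℕ.* k) ⟨
    2 ℕ.^ (s ℕ.+ 2 ℕ.* k)                   ≡⟨ cong (λ z → 2 ℕ.^ (s ℕ.+ z)) (ℕ.*-assoc 2 10 κ) ⟨
    2 ℕ.^ (s ℕ.+ 20 ℕ.* κ)                  ∎))
    where
    open ℕ.≤-Reasoning
    k = 10 ℕ.* κ
    W : Vec Bool k → Vec Bool s → ℕ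
    W x t = product (λ j → potential (vote t j) (lookup x j))
    heavy : ∀ x → 2 ℕ.^ (11 ℕ.* κ) ℕ.≤ W x (state x)
    -- A score is at most the logarithm of a squared potential, so 22 κ points bound the square of
    -- the product, and half of the exponent remains for the product itself.
    heavy x = square-cancel-≤ (begin
      2 ℕ.^ (11 ℕ.* κ) ℕ.* 2 ℕ.^ (11 ℕ.* κ)   ≡⟨ ℕ.^-distribˡ-+-* 2 (11 ℕ.* κ) (11 ℕ.* κ) ⟨
      2 ℕ.^ (11 ℕ.* κ ℕ.+ 11 ℕ.* κ)           ≡⟨ cong (2 ℕ.^_) (solve 1 (λ κ → con 11 :* κ :+ con 11 :* κ := con 22 :* κ) refl κ) ⟩
      2 ℕ.^ (22 ℕ.* κ)                        ≤⟨ ℕ.^-monoʳ-≤ 2 (h x) ⟩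
      2 ℕ.^ ℕΣ.sum (λ j → score (vote (state x) j) (lookup x j))
        ≤⟨ 2^sum≤product² (λ j → score (vote (state x) j) (lookup x j)) (λ j → potential (vote (state x) j) (lookup x j))
             (λ j → 2^score≤potential² (vote (state x) j) (lookup x j)) ⟩
      W x (state x) ℕ.* W x (state x) ∎)

  -- Numbers of blocks and queries for a given stream length

  -- With q = n / (1001 r), the stream has 1000 q blocks of r nodes, followed by
  -- m ≥ q r queries: m + r ≤ n / 400 and, for K ≥ 400 * 2002, also m K ≥ 400 n.
  module _ (r : ℕ) .{{_ : NonZero r}} where
    private
      T : ℕ
      T = 1001 ℕ.* r

      instance
        T≢0 : NonZero T
        T≢0 = ℕ.m*n≢0 1001 r

    module _ (n : ℕ) (n≥ : 1000 ℕ.* T ≤ℕ n) where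
      private
        q e m κ : ℕ
        q = n ℕ./ T
        e = n ℕ.% T
        m = e ℕ.+ q ℕ.* r
        κ = 100 ℕ.* q

      q≥1000 : 1000 ≤ℕ q
      q≥1000 = subst (_≤ℕ q) (ℕ.m*n/n≡m 1000 T) (ℕ./-monoˡ-≤ T n≥)

      n≡ : n ≡ 10 ℕ.* κ ℕ.* r ℕ.+ m
      n≡ = trans (ℕ.m≡m%n+[m/n]*n n T) (solve 3 (λ e q r → e :+ q :* (con 1001 :* r) := con 10 :* (con 100 :* q) :* r :+ (e :+ q :* r)) refl e q r)

      few-concerned : 400 ℕ.* (m ℕ.+ r) ≤ℕ 10 ℕ.* κ ℕ.* r ℕ.+ m
      few-concerned = begin
        400 ℕ.* (m ℕ.+ r)
          ≡⟨ solve 3 (λ e q r → con 400 :* (e :+ q :* r :+ r) := con 400 :* e :+ (con 400 :* q :+ con 400) :* r) refl e q r ⟩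
        400 ℕ.* e ℕ.+ (400 ℕ.* q ℕ.+ 400) ℕ.* r
          ≤⟨ ℕ.+-monoˡ-≤ _ (ℕ.*-monoʳ-≤ 400 (ℕ.<⇒≤ (ℕ.m%n<n n T))) ⟩
        400 ℕ.* (1001 ℕ.* r) ℕ.+ (400 ℕ.* q ℕ.+ 400) ℕ.* r
          ≡⟨ solve 2 (λ q r → con 400 :* (con 1001 :* r) :+ (con 400 :* q :+ con 400) :* r := (con 400 :* q :+ con 400800) :* r) refl q r ⟩
        (400 ℕ.* q ℕ.+ 400800) ℕ.* r
          -- The remainder e < 1001 r and the additional block cost 400 * 1001 + 400 = 400800 units
          -- of r. As q ≥ 1000, this is at most 601 q, and 400 + 601 = 1001 exhausts the 1000 q
          -- blocks and the q r of the queries.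
          ≤⟨ ℕ.*-monoˡ-≤ r (ℕ.+-monoʳ-≤ (400 ℕ.* q) (ℕ.≤-trans (ℕ.≤ᵇ⇒≤ 400800 601000 _) (ℕ.*-monoʳ-≤ 601 q≥1000))) ⟩
        (400 ℕ.* q ℕ.+ 601 ℕ.* q) ℕ.* r
          ≡⟨ solve 2 (λ q r → (con 400 :* q :+ con 601 :* q) :* r := con 10 :* (con 100 :* q) :* r :+ q :* r) refl q r ⟩
        10 ℕ.* κ ℕ.* r ℕ.+ q ℕ.* r
          ≤⟨ ℕ.+-monoʳ-≤ (10 ℕ.* κ ℕ.* r) (ℕ.m≤n+m (q ℕ.* r) e) ⟩
        10 ℕ.* κ ℕ.* r ℕ.+ m ∎
        where open ℕ.≤-Reasoning

      n≤2002qr : n ≤ℕ q ℕ.* (2002 ℕ.* r)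
      n≤2002qr = begin
        n                     ≡⟨ ℕ.m≡m%n+[m/n]*n n T ⟩
        e ℕ.+ q ℕ.* T         ≤⟨ ℕ.+-monoˡ-≤ (q ℕ.* T) (ℕ.<⇒≤ (ℕ.m%n<n n T)) ⟩
        -- Bounding the remainder by T ≤ q T doubles 1001 to 2002.
        T ℕ.+ q ℕ.* T         ≤⟨ ℕ.+-monoˡ-≤ (q ℕ.* T) (ℕ.m≤n*m T q {{ℕ.>-nonZero (ℕ.≤-trans (ℕ.s≤s ℕ.z≤n) q≥1000)}}) ⟩
        q ℕ.* T ℕ.+ q ℕ.* T   ≡⟨ solve 2 (λ q r → q :* (con 1001 :* r) :+ q :* (con 1001 :* r) := q :* (con 2002 :* r)) refl q r ⟩
        q ℕ.* (2002 ℕ.* r)    ∎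
        where open ℕ.≤-Reasoning

      many-queries : ∀ {K} → 800800 ≤ℕ K → 400 ℕ.* (10 ℕ.* κ ℕ.* r ℕ.+ m) ≤ℕ m ℕ.* K
      many-queries {K} K≥ = begin
        400 ℕ.* (10 ℕ.* κ ℕ.* r ℕ.+ m)   ≡⟨ cong (400 ℕ.*_) n≡ ⟨
        400 ℕ.* n                        ≤⟨ ℕ.*-monoʳ-≤ 400 n≤2002qr ⟩
        400 ℕ.* (q ℕ.* (2002 ℕ.* r))     ≡⟨ solve 2 (λ q r → con 400 :* (q :* (con 2002 :* r)) := q :* r :* con 800800) refl q r ⟩
        q ℕ.* r ℕ.* 800800               ≤⟨ ℕ.*-mono-≤ (ℕ.m≤n+m (q ℕ.* r) e) K≥ ⟩
        m ℕ.* K                          ∎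
        where open ℕ.≤-Reasoning

      sizes : Σ[ κ ∈ ℕ ] Σ[ m ∈ ℕ ] (NonZero κ × NonZero m × n ≡ 10 ℕ.* κ ℕ.* r ℕ.+ m ×
        400 ℕ.* (m ℕ.+ r) ≤ℕ 10 ℕ.* κ ℕ.* r ℕ.+ m × (∀ {K} → 800800 ≤ℕ K → 400 ℕ.* (10 ℕ.* κ ℕ.* r ℕ.+ m) ≤ℕ m ℕ.* K) ×
        n ≤ℕ κ ℕ.* (2002 ℕ.* r))
      sizes = κ , m , ℕ.m*n≢0 100 q {{_}} {{q≢0}} ,
        ℕ.>-nonZero (ℕ.≤-trans (ℕ.*-mono-≤ (ℕ.>-nonZero⁻¹ q {{q≢0}}) (ℕ.>-nonZero⁻¹ r)) (ℕ.m≤n+m (q ℕ.* r) e)) ,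
        n≡ , few-concerned , many-queries , ℕ.≤-trans n≤2002qr (ℕ.*-monoˡ-≤ (2002 ℕ.* r) (ℕ.m≤n*m q 100))
        where
        q≢0 : NonZero q
        q≢0 = ℕ.>-nonZero (ℕ.≤-trans (ℕ.s≤s ℕ.z≤n) q≥1000)

-- Naturals inside the rationals; rational inequalities

open +-*-Solver using (solve; _:=_; _:+_; _:*_; _:-_; con)

-- Opaque, since unification would otherwise unfold the gcd in _/_.
opaque
  ι : ℕ → ℚ
  ι n = + n / 1

  ι-def : ∀ n → ι n ≡ + n / 1
  ι-def n = refl

  ι≡ : ∀ n → toℚᵘ (ι n) ℚᵘ.≃ mkℚᵘ (+ n) 0
  ι≡ n = ℚ.toℚᵘ-fromℚᵘ (mkℚᵘ (+ n) 0)

ι-+ : ∀ a b → ι (a ℕ.+ b) ≡ ι a + ι b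
ι-+ a b = ℚ.toℚᵘ-injective (begin
  toℚᵘ (ι (a ℕ.+ b))     ≈⟨ ι≡ (a ℕ.+ b) ⟩
  mkℚᵘ (+ (a ℕ.+ b)) 0   ≈⟨ ℚᵘ.*≡* (cong (λ z → z ℤ.* + 1) (sym (cong₂ ℤ._+_ (ℤ.*-identityʳ (+ a)) (ℤ.*-identityʳ (+ b))))) ⟩
  mkℚᵘ (+ a) 0 ℚᵘ.+ mkℚᵘ (+ b) 0 ≈⟨ ℚᵘ.+-cong (ι≡ a) (ι≡ b) ⟨
  toℚᵘ (ι a) ℚᵘ.+ toℚᵘ (ι b)   ≈⟨ ℚ.toℚᵘ-homo-+ (ι a) (ι b) ⟨
  toℚᵘ (ι a + ι b)             ∎)
  where open ℚᵘ.≃-Reasoning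

ι-* : ∀ a b → ι (a ℕ.* b) ≡ ι a * ι b
ι-* a b = ℚ.toℚᵘ-injective (begin
  toℚᵘ (ι (a ℕ.* b))     ≈⟨ ι≡ (a ℕ.* b) ⟩
  mkℚᵘ (+ (a ℕ.* b)) 0   ≈⟨ ℚᵘ.*≡* (cong (λ z → z ℤ.* + 1) (ℤ.pos-* a b)) ⟩
  mkℚᵘ (+ a) 0 ℚᵘ.* mkℚᵘ (+ b) 0 ≈⟨ ℚᵘ.*-cong (ι≡ a) (ι≡ b) ⟨
  toℚᵘ (ι a) ℚᵘ.* toℚᵘ (ι b)   ≈⟨ ℚ.toℚᵘ-homo-* (ι a) (ι b) ⟨
  toℚᵘ (ι a * ι b)             ∎)
  where open ℚᵘ.≃-Reasoning

ι-mono : ∀ {a b} → a ℕ.≤ b → ι a ≤ ι b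
ι-mono {a} {b} a≤b = ℚ.toℚᵘ-cancel-≤ (begin
  toℚᵘ (ι a)   ≃⟨ ι≡ a ⟩
  mkℚᵘ (+ a) 0 ≤⟨ ℚᵘ.*≤* (ℤ.*-monoʳ-≤-nonNeg (+ 1) (ℤ.+≤+ a≤b)) ⟩
  mkℚᵘ (+ b) 0 ≃⟨ ι≡ b ⟨
  toℚᵘ (ι b)   ∎)
  where open ℚᵘ.≤-Reasoning

ι-cancel-≤ : ∀ {a b} → ι a ≤ ι b → a ℕ.≤ b
ι-cancel-≤ {a} {b} le with ℚᵘ.≤-respˡ-≃ (ι≡ a) (ℚᵘ.≤-respʳ-≃ (ι≡ b) (ℚ.toℚᵘ-mono-≤ le))
... | ℚᵘ.*≤* h = ℤ.drop‿+≤+ (subst₂ ℤ._≤_ (ℤ.*-identityʳ (+ a)) (ℤ.*-identityʳ (+ b)) h)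

/-*-ι : ∀ a b .{{_ : ℕ.NonZero b}} → (+ a / b) * ι b ≡ ι a
/-*-ι a (suc b) = ℚ.toℚᵘ-injective (begin
  toℚᵘ ((+ a / suc b) * ι (suc b))   ≈⟨ ℚ.toℚᵘ-homo-* (+ a / suc b) (ι (suc b)) ⟩
  toℚᵘ (+ a / suc b) ℚᵘ.* toℚᵘ (ι (suc b)) ≈⟨ ℚᵘ.*-cong (ℚ.toℚᵘ-fromℚᵘ (mkℚᵘ (+ a) b)) (ι≡ (suc b)) ⟩
  mkℚᵘ (+ a) b ℚᵘ.* mkℚᵘ (+ suc b) 0 ≈⟨ ℚᵘ.*≡* (trans (ℤ.*-identityʳ _) (cong (λ z → + a ℤ.* z) (cong (+_ ∘ suc) (sym (ℕ.*-identityʳ b))))) ⟩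
  mkℚᵘ (+ a) 0   ≈⟨ ι≡ a ⟨
  toℚᵘ (ι a)     ∎)
  where open ℚᵘ.≃-Reasoning

0≤ι : ∀ n → 0ℚ ≤ ι n
0≤ι n = subst (_≤ ι n) (ι-def 0) (ι-mono {0} ℕ.z≤n)

0<ι : ∀ n → 0ℚ < ι (suc n)
0<ι n = ℚ.<-≤-trans (*<* (ℤ.+<+ (ℕ.s≤s ℕ.z≤n))) (subst (_≤ ι (suc n)) (ι-def 1) (ι-mono {1} (ℕ.s≤s ℕ.z≤n)))

ι-suc : ∀ n → ι (suc n) ≡ 1ℚ + ι n
ι-suc n = trans (ι-+ 1 n) (cong (λ z → z + ι n) (ι-def 1))

0≤+ : ∀ {p q} → 0ℚ ≤ p → 0ℚ ≤ q → 0ℚ ≤ p + q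
0≤+ = ℚ.+-mono-≤

0≤* : ∀ {p q} → 0ℚ ≤ p → 0ℚ ≤ q → 0ℚ ≤ p * q
0≤* {p} {q} 0≤p 0≤q = ℚ.nonNegative⁻¹ (p * q) {{ℚ.nonNeg*nonNeg⇒nonNeg p {{nonNegative 0≤p}} q {{nonNegative 0≤q}}}}

0<* : ∀ {p q} → 0ℚ < p → 0ℚ < q → 0ℚ < p * q
0<* {p} {q} 0<p 0<q = ℚ.positive⁻¹ (p * q) {{ℚ.pos*pos⇒pos p {{positive 0<p}} q {{positive 0<q}}}}

0≤- : ∀ {p q} → p ≤ q → 0ℚ ≤ q - p
0≤- {p} {q} p≤q = subst (_≤ q - p) (ℚ.+-inverseʳ p) (ℚ.+-monoˡ-≤ (- p) p≤q)

-- Reduces a linear inequality to a ring identity.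
≤-by : ∀ {p q} d → 0ℚ ≤ d → p + d ≡ q → p ≤ q
≤-by {p} {q} d 0≤d eq = subst₂ _≤_ (ℚ.+-identityʳ p) eq (ℚ.+-monoʳ-≤ p 0≤d)

0<1/suc : ∀ k → 0ℚ < 1/suc k
0<1/suc k = ℚ.positive⁻¹ (1/suc k) {{ℚ.normalize-pos 1 (suc k)}}

-- A positive fraction is at least the reciprocal of its own denominator.
archimedean : ∀ e → 0ℚ < e → ∃[ k ] 1/suc k ≤ e
archimedean e@(mkℚ (+ zero)   d _) (*<* (ℤ.+<+ ()))
archimedean e@(mkℚ -[1+ a ] d _) (*<* ())
archimedean e@(mkℚ +[1+ a ] d _) _ = d , ℚ.toℚᵘ-cancel-≤
  (ℚᵘ.≤-respˡ-≃ (ℚᵘ.≃-sym (ℚ.toℚᵘ-fromℚᵘ (mkℚᵘ (+ 1) d)))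
    (ℚᵘ.*≤* (ℤ.*-monoʳ-≤-nonNeg (+ suc d) {+ 1} {+ suc a} (ℤ.+≤+ (ℕ.s≤s ℕ.z≤n)))))

∃ι≥ : ∀ q → ∃[ n ] q ≤ ι n
∃ι≥ (mkℚ (+ a) d _) = a , ℚ.toℚᵘ-cancel-≤
  (ℚᵘ.≤-respʳ-≃ (ℚᵘ.≃-sym (ι≡ a))
    (ℚᵘ.*≤* (ℤ.*-monoˡ-≤-nonNeg (+ a) {+ 1} {+ suc d} (ℤ.+≤+ (ℕ.s≤s ℕ.z≤n)))))
∃ι≥ (mkℚ -[1+ a ] d _) = 0 , ℚ.≤-trans (*≤* ℤ.-≤+) (0≤ι 0)

sum-mono : ∀ {n} {f g : Fin n → ℚ} → (∀ i → f i ≤ g i) → sum f ≤ sum g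
sum-mono {zero}  _   = ℚ.≤-refl
sum-mono {suc n} f≤g = ℚ.+-mono-≤ (f≤g zero) (sum-mono (f≤g ∘ suc))

sum-const : ∀ n q → sum {n} (λ _ → q) ≡ ι n * q
sum-const zero    q = sym (trans (cong (_* q) (ι-def 0)) (ℚ.*-zeroˡ q))
sum-const (suc n) q = begin
  q + sum {n} (λ _ → q) ≡⟨ cong (λ z → q + z) (sum-const n q) ⟩
  q + ι n * q      ≡⟨ solve 2 (λ q a → q :+ a :* q := (con 1ℚ :+ a) :* q) refl q (ι n) ⟩
  (1ℚ + ι n) * q   ≡⟨ cong (_* q) (ι-suc n) ⟨
  ι (suc n) * q    ∎
  where open ≡-Reasoning

-- Inequalities between limits

∀∞ : (ℕ → Set) → Set
∀∞ P = ∃[ N ] (∀ m → N ℕ.≤ m → P m)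

always : ∀ {P} → (∀ m → P m) → ∀∞ P
always p = 0 , λ m _ → p m

∀∞-map : ∀ {P Q} → (∀ m → P m → Q m) → ∀∞ P → ∀∞ Q
∀∞-map f (N , p) = N , λ m N≤m → f m (p m N≤m)

∀∞-map₂ : ∀ {P Q R} → (∀ m → P m → Q m → R m) → ∀∞ P → ∀∞ Q → ∀∞ R
∀∞-map₂ f (N , p) (N′ , q) = N ℕ.⊔ N′ , λ m N≤m →
  f m (p m (ℕ.≤-trans (ℕ.m≤m⊔n N N′) N≤m)) (q m (ℕ.≤-trans (ℕ.m≤n⊔m N N′) N≤m))

∀∞-× : ∀ {P Q} → ∀∞ P → ∀∞ Q → ∀∞ λ m → P m × Q m
∀∞-× = ∀∞-map₂ λ _ → _,_

-- ≤ᴿ with arbitrary positive tolerances; a record, so that its sides can be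
-- inferred.
infix 4 _≼_

record _≼_ (x y : Seq) : Set where
  constructor ≼-intro
  field within : ∀ e → 0ℚ < e → ∀∞ λ m → x m ≤ y m + e

open _≼_ public

from-≤ᴿ : ∀ {x y} → x ≤ᴿ y → x ≼ y
from-≤ᴿ {x} {y} x≤y .within e 0<e with archimedean e 0<e
... | k , 1/k≤e = ∀∞-map (λ m h → ℚ.≤-trans h (ℚ.+-monoʳ-≤ (y m) 1/k≤e)) (x≤y k)

≼-eventually : ∀ {x y} → ∀∞ (λ m → x m ≤ y m) → x ≼ y
≼-eventually {x} {y} h .within e 0<e =
  ∀∞-map (λ m x≤y → ℚ.≤-trans x≤y (≤-by e (ℚ.<⇒≤ 0<e) refl)) h

≼-pointwise : ∀ {x y} → (∀ m → x m ≤ y m) → x ≼ y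
≼-pointwise h = ≼-eventually (always h)

≼-reflexive : ∀ {x y} → (∀ m → x m ≡ y m) → x ≼ y
≼-reflexive h = ≼-pointwise λ m → ℚ.≤-reflexive (h m)

½*e+½*e : ∀ e → ½ * e + ½ * e ≡ e
½*e+½*e = solve 1 (λ e → con ½ :* e :+ con ½ :* e := e) refl

0<½* : ∀ {e} → 0ℚ < e → 0ℚ < ½ * e
0<½* = 0<* (ℚ.positive⁻¹ ½)

≼-trans : ∀ {x y z} → x ≼ y → y ≼ z → x ≼ z
≼-trans {x} {y} {z} x≤y y≤z = ≼-intro λ e 0<e → ∀∞-map₂
  (λ m p q → begin
     x m                     ≤⟨ p ⟩
     y m + ½ * e             ≤⟨ ℚ.+-monoˡ-≤ (½ * e) q ⟩
     z m + ½ * e + ½ * e     ≡⟨ ℚ.+-assoc (z m) _ _ ⟩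
     z m + (½ * e + ½ * e)   ≡⟨ cong (λ u → z m + u) (½*e+½*e e) ⟩
     z m + e                 ∎)
  (within x≤y (½ * e) (0<½* 0<e)) (within y≤z (½ * e) (0<½* 0<e))
  where open ≤-Reasoning

≼-+ : ∀ {x y z w} → x ≼ y → z ≼ w → x +ᴿ z ≼ y +ᴿ w
≼-+ {x} {y} {z} {w} x≤y z≤w = ≼-intro λ e 0<e → ∀∞-map₂
  (λ m p q → begin
     x m + z m   ≤⟨ ℚ.+-mono-≤ p q ⟩
     y m + ½ * e + (w m + ½ * e)
       ≡⟨ solve 3 (λ y w e → y :+ con ½ :* e :+ (w :+ con ½ :* e) := y :+ w :+ e) refl (y m) (w m) e ⟩
     y m + w m + e   ∎)
  (within x≤y (½ * e) (0<½* 0<e)) (within z≤w (½ * e) (0<½* 0<e))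
  where open ≤-Reasoning

≼-refl : ∀ {x} → x ≼ x
≼-refl = ≼-pointwise λ _ → ℚ.≤-refl

≼-∑ : ∀ {n} {x y : Fin n → Seq} → (∀ i → x i ≼ y i) → ∑ x ≼ ∑ y
≼-∑ {zero}  _ = ≼-refl
≼-∑ {suc n} h = ≼-+ (h zero) (≼-∑ (h ∘ suc))

-- Products respect _≼_ only for bounded sequences; convergence is not needed.
record Bounded (x : Seq) : Set where
  constructor _,_
  field
    bound : ℕ
    bounded : ∀∞ λ m → ∣ x m ∣ ≤ ι bound

record Nonneg (x : Seq) : Set where
  constructor _,_
  field
    0≼ : const 0ℚ ≼ x
    isBounded : Bounded x

open Nonneg public

bounded-≤ : ∀ {x} q → ∀∞ (λ m → ∣ x m ∣ ≤ q) → Bounded x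
bounded-≤ q h with ∃ι≥ q
... | n , q≤n = n , ∀∞-map (λ _ p → ℚ.≤-trans p q≤n) h

bounded-const : ∀ q → Bounded (const q)
bounded-const q = bounded-≤ ∣ q ∣ (always λ _ → ℚ.≤-refl)

bounded-+ : ∀ {x y} → Bounded x → Bounded y → Bounded (x +ᴿ y)
bounded-+ {x} {y} (B , b) (C , c) = bounded-≤ (ι B + ι C)
  (∀∞-map₂ (λ m p q → ℚ.≤-trans (ℚ.∣p+q∣≤∣p∣+∣q∣ (x m) (y m)) (ℚ.+-mono-≤ p q)) b c)

*-mono-≤-nonNeg : ∀ {p q r s} → 0ℚ ≤ p → 0ℚ ≤ s → p ≤ q → r ≤ s → p * r ≤ q * s
*-mono-≤-nonNeg {p} {q} {r} {s} 0≤p 0≤s p≤q r≤s = ℚ.≤-trans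
  (ℚ.*-monoˡ-≤-nonNeg p {{nonNegative 0≤p}} r≤s) (ℚ.*-monoʳ-≤-nonNeg s {{nonNegative 0≤s}} p≤q)

bounded-* : ∀ {x y} → Bounded x → Bounded y → Bounded (x *ᴿ y)
bounded-* {x} {y} (B , b) (C , c) = bounded-≤ (ι B * ι C)
  (∀∞-map₂ (λ m p q → subst (_≤ _) (sym (ℚ.∣p*q∣≡∣p∣*∣q∣ (x m) (y m))) (*-mono-≤-nonNeg (ℚ.0≤∣p∣ (x m)) (0≤ι C) p q)) b c)

bounded-ℝ : ∀ x → Bounded (seq x)
bounded-ℝ x with cauchy x 0
... | N , h = bounded-≤ (1/suc 0 + ∣ seq x N ∣) (N , λ m N≤m → begin
    ∣ seq x m ∣                           ≡⟨ cong ∣_∣ (solve 2 (λ a b → a := a :- b :+ b) refl (seq x m) (seq x N)) ⟩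
    ∣ seq x m - seq x N + seq x N ∣       ≤⟨ ℚ.∣p+q∣≤∣p∣+∣q∣ (seq x m - seq x N) (seq x N) ⟩
    ∣ seq x m - seq x N ∣ + ∣ seq x N ∣   ≤⟨ ℚ.+-monoˡ-≤ ∣ seq x N ∣ (h m N N≤m ℕ.≤-refl) ⟩
    1/suc 0 + ∣ seq x N ∣                 ∎)
  where open ≤-Reasoning

≤∣∣ : ∀ p → p ≤ ∣ p ∣
≤∣∣ p with ℚ.≤-total 0ℚ p
... | inj₁ 0≤p = ℚ.≤-reflexive (sym (ℚ.0≤p⇒∣p∣≡p 0≤p))
... | inj₂ p≤0 = ℚ.≤-trans p≤0 (ℚ.0≤∣p∣ p)

nonneg-+ : ∀ {x y} → Nonneg x → Nonneg y → Nonneg (x +ᴿ y)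
nonneg-+ {x} {y} (0≤x , bx) (0≤y , by) = ≼-trans (≼-reflexive λ _ → refl) (≼-+ 0≤x 0≤y) , bounded-+ {x} {y} bx by

nonneg-∑ : ∀ {n} {x : Fin n → Seq} → (∀ i → Nonneg (x i)) → Nonneg (∑ x)
nonneg-∑ {zero}  _ = ≼-refl , bounded-const 0ℚ
nonneg-∑ {suc n} {x} h = nonneg-+ {x zero} {∑ (x ∘ suc)} (h zero) (nonneg-∑ {x = x ∘ suc} (h ∘ suc))

nonneg-const : ∀ {q} → 0ℚ ≤ q → Nonneg (const q)
nonneg-const {q} 0≤q = ≼-pointwise (λ _ → 0≤q) , bounded-const q

-- If x, y ≥ -d and x ≤ B, y ≤ C with d ≤ 1, then (x + d)(y + d) ≥ 0 gives
-- x y ≥ -d (B + C + 1).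
nonneg-* : ∀ {x y} → Nonneg x → Nonneg y → Nonneg (x *ᴿ y)
nonneg-* {x} {y} (0≤x , bx@(B , b)) (0≤y , by@(C , c)) = ≼-intro step , bounded-* {x} {y} bx by
  where
  D = suc (B ℕ.+ C)
  step : ∀ e → 0ℚ < e → ∀∞ λ m → 0ℚ ≤ x m * y m + e
  -- The tolerance `d` is chosen at most e / D with D = B + C + 1, so that the total error d D stays
  -- below e.
  step e 0<e with archimedean (e * 1/suc (B ℕ.+ C)) (0<* 0<e (0<1/suc (B ℕ.+ C)))
  ... | k , d≤ = ∀∞-map₂ (λ { m (p , p′) (q , q′) → main m p q p′ q′ })
                   (∀∞-× (within 0≤x d (0<1/suc k)) b) (∀∞-× (within 0≤y d (0<1/suc k)) c)
    where
    d = 1/suc k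
    0≤d = ℚ.<⇒≤ (0<1/suc k)
    d≤1 : d ≤ 1ℚ
    d≤1 = ≤-by (ι k * d) (0≤* (0≤ι k) 0≤d) (begin
      d + ι k * d      ≡⟨ solve 2 (λ d k → d :+ k :* d := d :* (con 1ℚ :+ k)) refl d (ι k) ⟩
      d * (1ℚ + ι k)   ≡⟨ cong (d *_) (ι-suc k) ⟨
      d * ι (suc k)    ≡⟨ trans (/-*-ι 1 (suc k)) (ι-def 1) ⟩
      1ℚ               ∎)
      where open ≡-Reasoning
    dD≤e : d * (1ℚ + (ι B + ι C)) ≤ e
    dD≤e = begin
      d * (1ℚ + (ι B + ι C))        ≡⟨ cong (λ z → d * (1ℚ + z)) (ι-+ B C) ⟨
      d * (1ℚ + ι (B ℕ.+ C))        ≡⟨ cong (d *_) (ι-suc (B ℕ.+ C)) ⟨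
      d * ι D                       ≤⟨ ℚ.*-monoʳ-≤-nonNeg (ι D) {{nonNegative (0≤ι D)}} d≤ ⟩
      e * 1/suc (B ℕ.+ C) * ι D     ≡⟨ ℚ.*-assoc e _ _ ⟩
      e * (1/suc (B ℕ.+ C) * ι D)   ≡⟨ cong (e *_) (trans (/-*-ι 1 D) (ι-def 1)) ⟩
      e * 1ℚ                        ≡⟨ ℚ.*-identityʳ e ⟩
      e                             ∎
      where open ≤-Reasoning
    main : ∀ m → 0ℚ ≤ x m + d → 0ℚ ≤ y m + d → ∣ x m ∣ ≤ ι B → ∣ y m ∣ ≤ ι C → 0ℚ ≤ x m * y m + e
    main m p q p′ q′ = subst (0ℚ ≤_)
      (solve 6 (λ x y d e B C → (x :+ d) :* (y :+ d) :+ d :* (B :- x) :+ d :* (C :- y) :+ d :* (con 1ℚ :- d)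
          :+ (e :- d :* (con 1ℚ :+ (B :+ C))) := x :* y :+ e) refl (x m) (y m) d e (ι B) (ι C))
      (0≤+ (0≤+ (0≤+ (0≤+ (0≤* p q) (0≤* 0≤d (0≤- (ℚ.≤-trans (≤∣∣ (x m)) p′))))
                       (0≤* 0≤d (0≤- (ℚ.≤-trans (≤∣∣ (y m)) q′)))) (0≤* 0≤d (0≤- d≤1))) (0≤- dD≤e))

ℝ-nonneg : ∀ x → const 0ℚ ≤ᴿ seq x → Nonneg (seq x)
ℝ-nonneg x 0≤x = from-≤ᴿ 0≤x , bounded-ℝ x

bounded-- : ∀ {x y} → Bounded x → Bounded y → Bounded (x -ᴿ y)
bounded-- {x} {y} (B , b) (C , c) = bounded-≤ (ι B + ι C)
  (∀∞-map₂ (λ m p q → ℚ.≤-trans (ℚ.∣p-q∣≤∣p∣+∣q∣ (x m) (y m)) (ℚ.+-mono-≤ p q)) b c)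

nonneg-difference : ∀ {x y} → x ≼ y → Bounded y → Bounded x → Nonneg (y -ᴿ x)
nonneg-difference {x} {y} x≼y by bx = ≼-intro (λ e 0<e → ∀∞-map (λ m h → ≤-by (y m + e - x m) (0≤- h)
    (solve 3 (λ x y e → con 0ℚ :+ (y :+ e :- x) := y :- x :+ e) refl (x m) (y m) e)) (within x≼y e 0<e)) , bounded-- {y} {x} by bx

0≤1 : 0ℚ ≤ 1ℚ
0≤1 = *≤* (ℤ.+≤+ ℕ.z≤n)

-- Expectation functionals

-- Linearity holds exactly at every index, even for a factor that varies with the index, whereas
-- positivity and total mass 1 hold only in the limit, since the weights of a `Dist` are
-- representing sequences of reals.
record IsExpectation {S : Set} (P : (S → Seq) → Seq) : Set where
  field
    congᴱ      : ∀ {g h} m → (∀ t → g t m ≡ h t m) → P g m ≡ P h m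
    +-homo     : ∀ g h m → P (λ t → g t +ᴿ h t) m ≡ P g m + P h m
    *-homo     : ∀ c g m → P (λ t → c *ᴿ g t) m ≡ c m * P g m
    preserves  : ∀ {g} → (∀ t → Nonneg (g t)) → Nonneg (P g)
    1≼P1       : const 1ℚ ≼ P (λ _ → const 1ℚ)
    P1≼1       : P (λ _ → const 1ℚ) ≼ const 1ℚ

  0-homo : ∀ m → P (λ _ → const 0ℚ) m ≡ 0ℚ
  0-homo m = begin
    P (λ _ → const 0ℚ) m        ≡⟨ *-homo (const 0ℚ) (λ _ → const 0ℚ) m ⟩
    0ℚ * P (λ _ → const 0ℚ) m   ≡⟨ ℚ.*-zeroˡ (P (λ _ → const 0ℚ) m) ⟩
    0ℚ                          ∎
    where open ≡-Reasoning

  const-homo : ∀ (c : Seq) m → P (λ _ → c) m ≡ c m * P (λ _ → const 1ℚ) m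
  const-homo c m = trans (congᴱ m (λ _ → sym (ℚ.*-identityʳ (c m)))) (*-homo c (λ _ → const 1ℚ) m)

  sum-homo : ∀ {n} (g : Fin n → S → Seq) m → P (λ t → ∑ (λ i → g i t)) m ≡ sum (λ i → P (g i) m)
  sum-homo {zero}  g m = 0-homo m
  sum-homo {suc n} g m = trans (+-homo (g zero) (λ t → ∑ (λ i → g (suc i) t)) m)
    (cong (λ q → P (g zero) m + q) (sum-homo (g ∘ suc) m))

  -- By linearity the right side is the left side plus the expectation of the difference, which
  -- `preserves` makes nonnegative.
  mono : ∀ {g h} → (∀ t → Nonneg (h t -ᴿ g t)) → P g ≼ P h
  mono {g} {h} g≤h = ≼-trans
    (≼-trans (≼-reflexive λ m → sym (ℚ.+-identityʳ (P g m)))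
             (≼-+ {P g} ≼-refl (0≼ (preserves g≤h))))
    (≼-reflexive λ m → begin
      P g m + P (λ t → h t -ᴿ g t) m    ≡⟨ +-homo g (λ t → h t -ᴿ g t) m ⟨
      P (λ t → g t +ᴿ (h t -ᴿ g t)) m   ≡⟨ congᴱ m (λ t → solve 2 (λ a b → a :+ (b :- a) := b) refl (g t m) (h t m)) ⟩
      P h m                             ∎)
    where open ≡-Reasoning

open IsExpectation

module _ {A : Set} (μ : Dist A) where
  open Dist μ

  𝔼-isExpectation : IsExpectation (𝔼 μ)
  𝔼-isExpectation .congᴱ m g≡h = Sum.sum-cong-≗ λ i → cong (λ q → seq (weight i) m * q) (g≡h (point i))
  𝔼-isExpectation .+-homo g h m = trans
    (Sum.sum-cong-≗ λ i → ℚ.*-distribˡ-+ (seq (weight i) m) (g (point i) m) (h (point i) m))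
    (Sum.∑-distrib-+ (λ i → seq (weight i) m * g (point i) m) (λ i → seq (weight i) m * h (point i) m))
  𝔼-isExpectation .*-homo c g m = trans
    (Sum.sum-cong-≗ λ i → solve 3 (λ w c g → w :* (c :* g) := c :* (w :* g)) refl (seq (weight i) m) (c m) (g (point i) m))
    (sym (Sum.*-distribˡ-sum (c m) (λ i → seq (weight i) m * g (point i) m)))
  𝔼-isExpectation .preserves {g} 0≤g = nonneg-∑ {x = λ i → seq (weight i) *ᴿ g (point i)}
    λ i → nonneg-* {seq (weight i)} {g (point i)} (ℝ-nonneg (weight i) (nonneg i)) (0≤g (point i))
  𝔼-isExpectation .1≼P1 = ≼-trans (from-≤ᴿ (proj₂ total)) (≼-reflexive λ m → Sum.sum-cong-≗ λ i → sym (ℚ.*-identityʳ (seq (weight i) m)))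
  𝔼-isExpectation .P1≼1 = ≼-trans (≼-reflexive λ m → Sum.sum-cong-≗ λ i → ℚ.*-identityʳ (seq (weight i) m)) (from-≤ᴿ (proj₁ total))

identity-isExpectation : ∀ {S : Set} (t : S) → IsExpectation (λ g → g t)
identity-isExpectation t .congᴱ m h = h t
identity-isExpectation t .+-homo g h m = refl
identity-isExpectation t .*-homo c g m = refl
identity-isExpectation t .preserves h = h t
identity-isExpectation t .1≼P1 = ≼-refl
identity-isExpectation t .P1≼1 = ≼-refl

-- Running one random stage after another. The inner masses tend to 1 only in the limit, so `mono`
-- of the outer functional is needed to pass this on.
∘-isExpectation : ∀ {S T : Set} {P : (S → Seq) → Seq} {Q : S → (T → Seq) → Seq} →
  IsExpectation P → (∀ s → IsExpectation (Q s)) → IsExpectation (λ g → P (λ s → Q s g))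
∘-isExpectation EP EQ .congᴱ m h = congᴱ EP m λ s → congᴱ (EQ s) m h
∘-isExpectation {Q = Q} EP EQ .+-homo g h m = trans (congᴱ EP m λ s → +-homo (EQ s) g h m)
  (+-homo EP (λ s → Q s g) (λ s → Q s h) m)
∘-isExpectation {Q = Q} EP EQ .*-homo c g m = trans (congᴱ EP m λ s → *-homo (EQ s) c g m) (*-homo EP c (λ s → Q s g) m)
∘-isExpectation EP EQ .preserves h = preserves EP λ s → preserves (EQ s) h
∘-isExpectation {Q = Q} EP EQ .1≼P1 = ≼-trans (1≼P1 EP) (mono EP λ s →
  nonneg-difference (1≼P1 (EQ s)) (isBounded (preserves (EQ s) λ _ → nonneg-const 0≤1)) (bounded-const 1ℚ))
∘-isExpectation {Q = Q} EP EQ .P1≼1 = ≼-trans (mono EP λ s →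
  nonneg-difference (P1≼1 (EQ s)) (bounded-const 1ℚ) (isBounded (preserves (EQ s) λ _ → nonneg-const 0≤1))) (P1≼1 EP)

module _ {n u s} (M : Machine n u s) where
  open Machine M

  𝔼-scan-isExpectation : ∀ vs t → IsExpectation (λ g → 𝔼-scan M vs g t)
  𝔼-scan-isExpectation []       t = identity-isExpectation t
  𝔼-scan-isExpectation (v ∷ vs) t = ∘-isExpectation (𝔼-isExpectation (step v t)) (𝔼-scan-isExpectation vs)

  -- The continuation sees the prefix only through the memory state. This is what turns a one-pass
  -- algorithm into a one-way protocol.
  𝔼-scan-++ : ∀ vs ws g t m → 𝔼-scan M (vs ++ ws) g t m ≡ 𝔼-scan M vs (𝔼-scan M ws g) t m
  𝔼-scan-++ []       ws g t m = refl
  𝔼-scan-++ (v ∷ vs) ws g t m = congᴱ (𝔼-isExpectation (step v t)) {𝔼-scan M (vs ++ ws) g} {𝔼-scan M vs (𝔼-scan M ws g)} m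
    λ t′ → 𝔼-scan-++ vs ws g t′ m

-- A memory state at least as good as the average

maximum : ∀ {n} → (Vec Bool n → ℕ) → ℕ
maximum {zero}  f = f []
maximum {suc n} f = maximum (f ∘ (true ∷_)) ℕ.⊔ maximum (f ∘ (false ∷_))

≤maximum : ∀ {n} (f : Vec Bool n → ℕ) t → f t ℕ.≤ maximum f
≤maximum f []          = ℕ.≤-refl
≤maximum f (true  ∷ t) = ℕ.≤-trans (≤maximum (f ∘ (true ∷_)) t) (ℕ.m≤m⊔n _ _)
≤maximum f (false ∷ t) = ℕ.≤-trans (≤maximum (f ∘ (false ∷_)) t) (ℕ.m≤n⊔m _ _)

maximum-attained : ∀ {n} (f : Vec Bool n → ℕ) → ∃[ t ] maximum f ≡ f t
maximum-attained {zero}  f = [] , refl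
maximum-attained {suc n} f with ℕ.⊔-sel (maximum (f ∘ (true ∷_))) (maximum (f ∘ (false ∷_)))
... | inj₁ eq = true ∷ proj₁ p , trans eq (proj₂ p)
  where p = maximum-attained (f ∘ (true ∷_))
... | inj₂ eq = false ∷ proj₁ p , trans eq (proj₂ p)
  where p = maximum-attained (f ∘ (false ∷_))

bounded-ι : ∀ {B} (f : ℕ → ℕ) → (∀ m → f m ℕ.≤ B) → Bounded (λ m → ι (f m))
bounded-ι {B} f f≤B = B , always λ m →
  subst (_≤ ι B) (sym (ℚ.0≤p⇒∣p∣≡p (0≤ι (f m)))) (ι-mono (f≤B m))

-- The expectation is at most the maximum over all states. The maximising state may change with the
-- index, so it is chosen after the index; for natural values bounded by `B` the sequence of maxima
-- is bounded, though it need not converge.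
expectation-attained : ∀ {s} {P : (Vec Bool s → Seq) → Seq} → IsExpectation P →
  ∀ {B q} (g : Vec Bool s → ℕ → ℕ) → (∀ t m → g t m ℕ.≤ B) →
  const q ≼ P (λ t m → ι (g t m)) →
  ∀ e → 0ℚ < e → ∀∞ λ m → ∃[ t ] q ≤ ι (g t m) + e
expectation-attained {P = P} E {B} {q} g g≤B q≼Pg e 0<e =
  ∀∞-map (λ m h → proj₁ (maximum-attained (λ t → g t m)) ,
                  subst (λ a → q ≤ ι a + e) (proj₂ (maximum-attained (λ t → g t m))) h)
    (within q≼top e 0<e)
  where
  top : ℕ → ℕ
  top m = maximum (λ t → g t m)

  top≤B : ∀ m → top m ℕ.≤ B
  top≤B m with maximum-attained (λ t → g t m)
  ... | t , eq = subst (ℕ._≤ B) (sym eq) (g≤B t m)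

  ιtop : Seq
  ιtop m = ι (top m)

  P1 : Seq
  P1 = P (λ _ → const 1ℚ)

  -- At a single index the total mass `P1` need not be 1. Adding this term, nonnegative in the
  -- limit, replaces top * P1 by top.
  slack : Nonneg (ιtop *ᴿ (const 1ℚ -ᴿ P1))
  slack = nonneg-* {ιtop} {const 1ℚ -ᴿ P1} (≼-pointwise (λ m → 0≤ι (top m)) , bounded-ι top top≤B)
    (nonneg-difference (P1≼1 E) (bounded-const 1ℚ) (isBounded (preserves E λ _ → nonneg-const 0≤1)))

  q≼top : const q ≼ ιtop
  q≼top = ≼-trans (≼-trans q≼Pg (mono E {h = λ _ → ιtop} λ t →
      ≼-pointwise (λ m → 0≤- (ι-mono (≤maximum (λ t → g t m) t))) ,
      bounded-- {ιtop} (bounded-ι top top≤B) (bounded-ι (g t) (g≤B t))))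
    (≼-trans (≼-trans (≼-reflexive λ m → sym (ℚ.+-identityʳ (P (λ _ → ιtop) m))) (≼-+ {P (λ _ → ιtop)} ≼-refl (0≼ slack)))
      (≼-reflexive λ m → trans (cong (λ z → z + ιtop m * (1ℚ - P1 m)) (const-homo E ιtop m))
        (solve 2 (λ a p → a :* p :+ a :* (con 1ℚ :- p) := a) refl (ιtop m) (P1 m))))

-- Votes, scores and the index problem

¼ : ℚ
¼ = + 1 / 4

vote : ℚ → ℚ → Maybe Bool
vote a b with ¼ ℚ.≤? a - b | ¼ ℚ.≤? b - a
... | yes _ | _     = just true
... | no  _ | yes _ = just false
... | no  _ | no  _ = nothing

0≤/ : ∀ a b .{{_ : ℕ.NonZero b}} → 0ℚ ≤ + a / b
0≤/ a b = ℚ.nonNegative⁻¹ (+ a / b) {{ℚ.normalize-nonNeg a b}}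

-- a and b are the probabilities of a right and of a wrong answer, up to an error d.
module _ (a b : ℚ) {d : ℚ} (0≤a : 0ℚ ≤ a + d) (0≤b : 0ℚ ≤ b + d) (a+b≤1 : 0ℚ ≤ 1ℚ - a - b + d) where
  private
    estimate : ℕ → Set
    estimate n = + 7 / 4 + a ≤ ι n + + 9 / 1 * b + + 20 / 1 * d

  score-right : 0ℚ ≤ d → estimate 3
  score-right 0≤d = ≤-by (1ℚ - a - b + d + + 10 / 1 * (b + d) + ¼ + + 9 / 1 * d)
    (0≤+ (0≤+ (0≤+ a+b≤1 (0≤* (0≤/ 10 1) 0≤b)) (0≤/ 1 4)) (0≤* (0≤/ 9 1) 0≤d))
    (trans (solve 3 (λ a b d → con (+ 7 / 4) :+ a :+ (con 1ℚ :- a :- b :+ d :+ con (+ 10 / 1) :* (b :+ d) :+ con ¼ :+ con (+ 9 / 1) :* d)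
       := con (+ 3 / 1) :+ con (+ 9 / 1) :* b :+ con (+ 20 / 1) :* d) refl a b d)
      (cong (λ z → z + + 9 / 1 * b + + 20 / 1 * d) (sym (ι-def 3))))

  score-neutral : 0ℚ ≤ d → a - b ≤ ¼ → estimate 2
  score-neutral 0≤d small = ≤-by (¼ - (a - b) + + 8 / 1 * (b + d) + + 12 / 1 * d)
    (0≤+ (0≤+ (0≤- small) (0≤* (0≤/ 8 1) 0≤b)) (0≤* (0≤/ 12 1) 0≤d))
    (trans (solve 3 (λ a b d → con (+ 7 / 4) :+ a :+ (con ¼ :- (a :- b) :+ con (+ 8 / 1) :* (b :+ d) :+ con (+ 12 / 1) :* d)
       := con (+ 2 / 1) :+ con (+ 9 / 1) :* b :+ con (+ 20 / 1) :* d) refl a b d)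
      (cong (λ z → z + + 9 / 1 * b + + 20 / 1 * d) (sym (ι-def 2))))

  score-wrong : 0ℚ ≤ d → ¼ ≤ b - a → estimate 0
  score-wrong 0≤d large = ≤-by (+ 9 / 1 * (b - a - ¼) + + 8 / 1 * (a + d) + ½ + + 12 / 1 * d)
    (0≤+ (0≤+ (0≤+ (0≤* (0≤/ 9 1) (0≤- large)) (0≤* (0≤/ 8 1) 0≤a)) (0≤/ 1 2)) (0≤* (0≤/ 12 1) 0≤d))
    (trans (solve 3 (λ a b d → con (+ 7 / 4) :+ a :+ (con (+ 9 / 1) :* (b :- a :- con ¼) :+ con (+ 8 / 1) :* (a :+ d) :+ con ½ :+ con (+ 12 / 1) :* d)
       := con 0ℚ :+ con (+ 9 / 1) :* b :+ con (+ 20 / 1) :* d) refl a b d)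
      (cong (λ z → z + + 9 / 1 * b + + 20 / 1 * d) (sym (ι-def 0))))

≰⇒≥ : ∀ {p q} → (p ≤ q → ⊥) → q ≤ p
≰⇒≥ p≰q = ℚ.<⇒≤ (ℚ.≰⇒> p≰q)

swap-1-- : ∀ a b d → 1ℚ - a - b + d ≡ 1ℚ - b - a + d
swap-1-- = solve 3 (λ a b d → con 1ℚ :- a :- b :+ d := con 1ℚ :- b :- a :+ d) refl

-- A lower bound of the score that is linear in the answer probabilities and hence can be averaged
-- over the memory. A right vote uses that probabilities are at most 1; an abstention, that they
-- differ by at most `¼`; a wrong vote, that the wrong answer leads by at least `¼`, which the
-- coefficient 9 magnifies above 7/4. The term 20 d pays for bounds that hold only up to `d`.
score-bound : ∀ (V : Bool → ℚ) c {d} → 0ℚ ≤ d → 0ℚ ≤ V true + d → 0ℚ ≤ V false + d → 0ℚ ≤ 1ℚ - V true - V false + d →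
  + 7 / 4 + V c ≤ ι (score (vote (V true) (V false)) c) + + 9 / 1 * V (not c) + + 20 / 1 * d
score-bound V true 0≤d p q r with ¼ ℚ.≤? V true - V false | ¼ ℚ.≤? V false - V true
... | yes _ | _       = score-right (V true) (V false) p q r 0≤d
... | no  h | yes h′  = score-wrong (V true) (V false) p q r 0≤d h′
... | no  h | no  _   = score-neutral (V true) (V false) p q r 0≤d (≰⇒≥ h)
score-bound V false {d} 0≤d p q r with ¼ ℚ.≤? V true - V false | ¼ ℚ.≤? V false - V true
... | yes h | _       = score-wrong (V false) (V true) q p (subst (0ℚ ≤_) (swap-1-- (V true) (V false) d) r) 0≤d h
... | no  h | yes _   = score-right (V false) (V true) q p (subst (0ℚ ≤_) (swap-1-- (V true) (V false) d) r) 0≤d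
... | no  _ | no  h   = score-neutral (V false) (V true) q p (subst (0ℚ ≤_) (swap-1-- (V true) (V false) d) r) 0≤d (≰⇒≥ h)

-- There are finitely many strings, so one threshold serves them all.
∀∞-bits : ∀ {n} {P : Vec Bool n → ℕ → Set} → (∀ x → ∀∞ (P x)) → ∀∞ (λ m → ∀ x → P x m)
∀∞-bits {zero}  p = ∀∞-map (λ { m h [] → h }) (p [])
∀∞-bits {suc n} p = ∀∞-map₂ (λ { m h h′ (true ∷ x) → h x ; m h h′ (false ∷ x) → h′ x })
  (∀∞-bits (p ∘ (true ∷_))) (∀∞-bits (p ∘ (false ∷_)))

ι-sum : ∀ {n} (f : Fin n → ℕ) → ι (ℕΣ.sum f) ≡ sum (λ i → ι (f i))
ι-sum {zero}  f = ι-def 0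
ι-sum {suc n} f = trans (ι-+ (f zero) (ℕΣ.sum (f ∘ suc))) (cong (λ z → ι (f zero) + z) (ι-sum (f ∘ suc)))

sum-≤ : ∀ {n B} (f : Fin n → ℕ) → (∀ i → f i ℕ.≤ B) → ℕΣ.sum f ℕ.≤ n ℕ.* B
sum-≤ {zero}  f f≤B = ℕ.z≤n
sum-≤ {suc n} f f≤B = ℕ.+-mono-≤ (f≤B zero) (sum-≤ (f ∘ suc) (f≤B ∘ suc))

bounded-by-const-* : ∀ {x} q → Bounded x → Bounded (const q *ᴿ x)
bounded-by-const-* {x} q bx = bounded-* {const q} {x} (bounded-const q) bx

-- The index problem in abstract form: `P x` averages over the memory after storing x, and `V c j t`
-- is the probability that the query for the bit j, started in state t, is answered by c.
module _ {κ s : ℕ}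
  (P : Vec Bool (10 ℕ.* κ) → (Vec Bool s → Seq) → Seq) (EP : ∀ x → IsExpectation (P x))
  (V : Bool → Fin (10 ℕ.* κ) → Vec Bool s → Seq)
  (0≼V : ∀ c j t → Nonneg (V c j t))
  (V≼1 : ∀ j t → V true j t +ᴿ V false j t ≼ const 1ℚ)
  (right : ∀ x j → const (+ 101 / 200) ≼ P x (V (lookup x j) j))
  (wrong : ∀ x j → P x (V (not (lookup x j)) j) ≼ const (+ 1 / 200))
  where

  private
    k = 10 ℕ.* κ

    voteAt : ℕ → Vec Bool s → Fin k → Maybe Bool
    voteAt m t j = vote (V true j t m) (V false j t m)

    score₁ : Vec Bool k → Fin k → Vec Bool s → ℕ → ℕ
    score₁ x j t m = score (voteAt m t j) (lookup x j)

    total : Vec Bool k → Vec Bool s → ℕ → ℕ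
    total x t m = ℕΣ.sum (λ j → score₁ x j t m)

    ιscore : Vec Bool k → Fin k → Vec Bool s → Seq
    ιscore x j t m = ι (score₁ x j t m)

    -- The slack in `score-bound` as a function of the state; its expectation is nonnegative in the
    -- limit.
    gap : Vec Bool k → Fin k → Vec Bool s → Seq
    gap x j t = ιscore x j t +ᴿ const (+ 9 / 1) *ᴿ V (not (lookup x j)) j t -ᴿ (const (+ 7 / 4) +ᴿ V (lookup x j) j t)

    0≼gap : ∀ x j t → Nonneg (gap x j t)
    0≼gap x j t = ≼-intro (λ e 0<e → let d = + 1 / 20 * e ; 0<d = 0<* (0<1/suc 19) 0<e in
      ∀∞-map₂ (λ { m (p , q) r → ≤-by _
        (0≤- (score-bound (λ c → V c j t m) (lookup x j) (ℚ.<⇒≤ 0<d) p q (subst (0ℚ ≤_)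
            (solve 3 (λ a b d → con 1ℚ :+ d :- (a :+ b) := con 1ℚ :- a :- b :+ d) refl (V true j t m) (V false j t m) d) (0≤- r))))
        (solve 4 (λ s b a e → con 0ℚ :+ (s :+ con (+ 9 / 1) :* b :+ con (+ 20 / 1) :* (con (+ 1 / 20) :* e) :- (con (+ 7 / 4) :+ a))
           := s :+ con (+ 9 / 1) :* b :- (con (+ 7 / 4) :+ a) :+ e) refl (ιscore x j t m) (V (not (lookup x j)) j t m) (V (lookup x j) j t m) e) })
        (∀∞-× (within (0≼ (0≼V true j t)) d 0<d) (within (0≼ (0≼V false j t)) d 0<d)) (within (V≼1 j t) d 0<d)) ,
      bounded-- {ιscore x j t +ᴿ const (+ 9 / 1) *ᴿ V (not (lookup x j)) j t} {const (+ 7 / 4) +ᴿ V (lookup x j) j t}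
        (bounded-+ {ιscore x j t} {const (+ 9 / 1) *ᴿ V (not (lookup x j)) j t}
           (bounded-ι (score₁ x j t) (λ m → score≤3 (voteAt m t j) (lookup x j)))
           (bounded-by-const-* {V (not (lookup x j)) j t} (+ 9 / 1) (isBounded (0≼V (not (lookup x j)) j t))))
        (bounded-+ {const (+ 7 / 4)} {V (lookup x j) j t} (bounded-const (+ 7 / 4)) (isBounded (0≼V (lookup x j) j t)))

    expand : ∀ x j m → P x (ιscore x j) m ≡
      P x (gap x j) m + + 7 / 4 * P x (λ _ → const 1ℚ) m + P x (V (lookup x j) j) m - + 9 / 1 * P x (V (not (lookup x j)) j) m
    expand x j m = begin
      S                               ≡⟨ solve 2 (λ s b → s := s :+ con (+ 9 / 1) :* b :- con (+ 9 / 1) :* b) refl S B ⟩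
      S + + 9 / 1 * B - + 9 / 1 * B   ≡⟨ cong (λ z → z - + 9 / 1 * B) both ⟩
      G + + 7 / 4 * O + A - + 9 / 1 * B ∎
      where
      open ≡-Reasoning
      E = EP x
      S = P x (ιscore x j) m
      B = P x (V (not (lookup x j)) j) m
      A = P x (V (lookup x j) j) m
      G = P x (gap x j) m
      O = P x (λ _ → const 1ℚ) m
      both : S + + 9 / 1 * B ≡ G + + 7 / 4 * O + A
      both = begin
        S + + 9 / 1 * B ≡⟨ cong (λ z → S + z) (*-homo E (const (+ 9 / 1)) (V (not (lookup x j)) j) m) ⟨
        S + P x (λ t → const (+ 9 / 1) *ᴿ V (not (lookup x j)) j t) m ≡⟨ +-homo E (ιscore x j) (λ t → const (+ 9 / 1) *ᴿ V (not (lookup x j)) j t) m ⟨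
        P x (λ t → ιscore x j t +ᴿ const (+ 9 / 1) *ᴿ V (not (lookup x j)) j t) m
          ≡⟨ congᴱ E m (λ t → solve 3 (λ s b a → s :+ con (+ 9 / 1) :* b := (s :+ con (+ 9 / 1) :* b :- (con (+ 7 / 4) :+ a)) :+ con (+ 7 / 4) :+ a)
                refl (ιscore x j t m) (V (not (lookup x j)) j t m) (V (lookup x j) j t m)) ⟩
        P x (λ t → gap x j t +ᴿ const (+ 7 / 4) +ᴿ V (lookup x j) j t) m ≡⟨ +-homo E (λ t → gap x j t +ᴿ const (+ 7 / 4)) (V (lookup x j) j) m ⟩
        P x (λ t → gap x j t +ᴿ const (+ 7 / 4)) m + A ≡⟨ cong (λ z → z + A) (+-homo E (gap x j) (λ _ → const (+ 7 / 4)) m) ⟩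
        G + P x (λ _ → const (+ 7 / 4)) m + A ≡⟨ cong (λ z → G + z + A) (const-homo E (const (+ 7 / 4)) m) ⟩
        G + + 7 / 4 * O + A ∎

    -- The constant is 7/4 + 101/200 - 9/200. Of the tolerance e, the errors use 1 + 7/4 + 1 + 9 =
    -- 51/4 shares of e / 20, which leaves 29/80 of e.
    expected : ∀ x j → const (+ 221 / 100) ≼ P x (ιscore x j)
    expected x j = ≼-intro λ e 0<e → let d = + 1 / 20 * e ; 0<d = 0<* (0<1/suc 19) 0<e in
      ∀∞-map₂ (λ { m (g , o) (a , b) → subst (λ z → + 221 / 100 ≤ z + e) (sym (expand x j m)) (≤-by _
          (0≤+ (0≤+ (0≤+ (0≤+ g (0≤* (0≤/ 7 4) (0≤- o))) (0≤- a)) (0≤* (0≤/ 9 1) (0≤- b))) (0≤* (0≤/ 29 80) (ℚ.<⇒≤ 0<e)))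
          (solve 5 (λ g o a b e → let d = con (+ 1 / 20) :* e in
              con (+ 221 / 100) :+ (g :+ d :+ con (+ 7 / 4) :* (o :+ d :- con 1ℚ) :+ (a :+ d :- con (+ 101 / 200))
                 :+ con (+ 9 / 1) :* (con (+ 1 / 200) :+ d :- b) :+ con (+ 29 / 80) :* e)
              := g :+ con (+ 7 / 4) :* o :+ a :- con (+ 9 / 1) :* b :+ e)
            refl (P x (gap x j) m) (P x (λ _ → const 1ℚ) m) (P x (V (lookup x j) j) m) (P x (V (not (lookup x j)) j) m) e)) })
        (∀∞-× (within (0≼ (preserves (EP x) (0≼gap x j))) d 0<d) (within (1≼P1 (EP x)) d 0<d))
        (∀∞-× (within (right x j) d 0<d) (within (wrong x j) d 0<d))

    expected-total : ∀ x → const (ι k * (+ 221 / 100)) ≼ P x (λ t m → ι (total x t m))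
    expected-total x = ≼-trans (≼-reflexive λ m → sym (sum-const k (+ 221 / 100)))
      (≼-trans (≼-∑ (expected x)) (≼-reflexive λ m → begin
        sum (λ j → P x (ιscore x j) m)         ≡⟨ sum-homo (EP x) (ιscore x) m ⟨
        P x (λ t → ∑ (λ j → ιscore x j t)) m   ≡⟨ congᴱ (EP x) m (λ t → ι-sum (λ j → score₁ x j t m)) ⟨
        P x (λ t m → ι (total x t m)) m        ∎))
      where open ≡-Reasoning

  index-bound : .{{_ : ℕ.NonZero κ}} → κ ℕ.≤ s
  index-bound = few-states κ (voteAt N) (λ x → proj₁ (found x)) λ x →
      ι-cancel-≤ (high (total x (proj₁ (found x)) N) (proj₂ (found x)))
    where
    high-states : ∀∞ λ m → ∀ x → ∃[ t ] ι k * (+ 221 / 100) ≤ ι (total x t m) + + 1 / 10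
    high-states = ∀∞-bits λ x → expectation-attained (EP x) (total x)
      (λ t m → sum-≤ (λ j → score₁ x j t m) (λ j → score≤3 (voteAt m t j) (lookup x j)))
      (expected-total x) (+ 1 / 10) (0<1/suc 9)

    -- The single index at which all votes are read off; each string has a state of high score
    -- there.
    N : ℕ
    N = proj₁ high-states

    found : ∀ x → ∃[ t ] ι k * (+ 221 / 100) ≤ ι (total x t N) + + 1 / 10
    found = proj₂ high-states N ℕ.≤-refl

    1≤κ : 1ℚ ≤ ι κ
    1≤κ = subst (_≤ ι κ) (ι-def 1) (ι-mono (ℕ.>-nonZero⁻¹ κ))

    high : ∀ a → ι k * (+ 221 / 100) ≤ ι a + + 1 / 10 → ι (22 ℕ.* κ) ≤ ι a
    -- The average 221/100 over 10 κ bits gives 22 κ + κ / 10, and κ ≥ 1 pays for the tolerance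
    -- 1/10.
    high a h = ≤-by (ι a + + 1 / 10 - ι k * (+ 221 / 100) + + 1 / 10 * (ι κ - 1ℚ))
      (0≤+ (0≤- h) (0≤* (0≤/ 1 10) (0≤- 1≤κ)))
      (trans (cong₂ (λ p q → p + (ι a + + 1 / 10 - q * (+ 221 / 100) + + 1 / 10 * (ι κ - 1ℚ)))
           (trans (ι-* 22 κ) (cong (_* ι κ) (ι-def 22))) (trans (ι-* 10 κ) (cong (_* ι κ) (ι-def 10))))
        (solve 2 (λ a κ → con (+ 22 / 1) :* κ :+ (a :+ con (+ 1 / 10) :- con (+ 10 / 1) :* κ :* con (+ 221 / 100) :+ con (+ 1 / 10) :* (κ :- con 1ℚ)) := a) refl (ι a) (ι κ)))

-- Bounds on rational powers

≤greatest : ∀ P {b j} → P j ≡ true → j ℕ.≤ b → j ℕ.≤ greatest P b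
≤greatest P {zero}  _ ℕ.z≤n = ℕ.z≤n
≤greatest P {suc b} {j} Pj j≤b with P (suc b) in eq
... | true  = j≤b
... | false with ℕ.m≤n⇒m<n∨m≡n j≤b
...   | inj₁ j<1+b = ≤greatest P Pj (ℕ.s≤s⁻¹ j<1+b)
...   | inj₂ refl with () ← trans (sym eq) Pj

greatest-satisfies : ∀ P b → greatest P b ≡ 0 ⊎ P (greatest P b) ≡ true
greatest-satisfies P zero = inj₁ refl
greatest-satisfies P (suc b) with P (suc b) in eq
... | true  = inj₂ eq
... | false = greatest-satisfies P b

ι-/ : ∀ N c .{{_ : ℕ.NonZero N}} → + (c ℕ.* N) / N ≡ ι c
ι-/ N@(suc n) c = ℚ.≤-antisym (cancel (ℚ.≤-reflexive eq)) (cancel (ℚ.≤-reflexive (sym eq)))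
  where
  eq : + (c ℕ.* N) / N * ι N ≡ ι c * ι N
  eq = trans (/-*-ι (c ℕ.* N) N) (ι-* c N)
  cancel : ∀ {p q} → p * ι N ≤ q * ι N → p ≤ q
  cancel = ℚ.*-cancelʳ-≤-pos (ι N) {{positive (0<ι n)}}

/-mono : ∀ {a b} N .{{_ : ℕ.NonZero N}} → a ℕ.≤ b → + a / N ≤ + b / N
/-mono {a} {b} N@(suc n) a≤b = ℚ.*-cancelʳ-≤-pos (ι N) {{positive (0<ι n)}}
  (subst₂ _≤_ (sym (/-*-ι a N)) (sym (/-*-ι b N)) (ι-mono a≤b))

0≤^ : ∀ {p} b → 0ℚ ≤ p → 0ℚ ≤ p ^ℚ b
0≤^ zero    0≤p = 0≤1
0≤^ (suc b) 0≤p = 0≤* 0≤p (0≤^ b 0≤p)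

^-mono-≤ : ∀ {p q} b → 0ℚ ≤ p → p ≤ q → p ^ℚ b ≤ q ^ℚ b
^-mono-≤ zero    0≤p p≤q = ℚ.≤-refl
^-mono-≤ (suc b) 0≤p p≤q = *-mono-≤-nonNeg 0≤p (0≤^ b (ℚ.≤-trans 0≤p p≤q)) p≤q (^-mono-≤ b 0≤p p≤q)

1^ : ∀ a → 1ℚ ^ℚ a ≡ 1ℚ
1^ zero    = refl
1^ (suc a) = trans (ℚ.*-identityˡ (1ℚ ^ℚ a)) (1^ a)

1≤^ : ∀ {p} b → 1ℚ ≤ p → 1ℚ ≤ p ^ℚ b
1≤^ {p} b 1≤p = subst (_≤ p ^ℚ b) (1^ b) (^-mono-≤ b 0≤1 1≤p)

p≤p^suc : ∀ {p} b → 1ℚ ≤ p → p ≤ p ^ℚ suc b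
p≤p^suc {p} b 1≤p = subst (_≤ p ^ℚ suc b) (ℚ.*-identityʳ p)
  (ℚ.*-monoˡ-≤-nonNeg p {{nonNegative (ℚ.≤-trans 0≤1 1≤p)}} (1≤^ b 1≤p))

ι-^ : ∀ K b → ι K ^ℚ b ≡ ι (K ℕ.^ b)
ι-^ K zero    = sym (ι-def 1)
ι-^ K (suc b) = trans (cong (λ z → ι K * z) (ι-^ K b)) (sym (ι-* K (K ℕ.^ b)))

0≤rationalPower : ∀ x q N .{{_ : ℕ.NonZero N}} → 0ℚ ≤ rationalPower x q N
0≤rationalPower x q N = 0≤/ (greatest (λ j → (+ j / N) ^ℚ ↧ₙ q ≤ᵇ x ^ℚ ℤ.∣ ↥ q ∣) (N ℕ.* (1 ℕ.+ ℤ.∣ ↥ x ∣) ℕ.^ ℤ.∣ ↥ q ∣)) N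

-- The search predicate inside `rationalPower`, with numerator and denominator of the exponent as
-- parameters.
below : (a b : ℕ) → ℚ → (N : ℕ) → .{{ℕ.NonZero N}} → ℕ → Bool
below a b x N j = (+ j / N) ^ℚ b ≤ᵇ x ^ℚ a

-- The integer c equals c N / N, so c N is one of the candidates of the search.
≤greatest-below : ∀ a b x N .{{_ : ℕ.NonZero N}} c {B} → ι c ^ℚ b ≤ x ^ℚ a → c ℕ.* N ℕ.≤ B →
  ι c ≤ + greatest (below a b x N) B / N
≤greatest-below a b x N c {B} c^b≤x^a c≤ = subst (λ z → z ≤ + greatest (below a b x N) B / N) (ι-/ N c)
  (/-mono {c ℕ.* N} {greatest (below a b x N) B} N (≤greatest (below a b x N) {B} {c ℕ.* N} holds c≤))
  where
  holds : below a b x N (c ℕ.* N) ≡ true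
  holds = Equivalence.to Bool.T-≡ (ℚ.≤⇒≤ᵇ {(+ (c ℕ.* N) / N) ^ℚ b} {x ^ℚ a}
    (subst (λ z → z ^ℚ b ≤ x ^ℚ a) (sym (ι-/ N c)) c^b≤x^a))

-- If 1 ≤ y, then y is at most its power with positive exponent, which is at most 1.
^≤1⇒≤1 : ∀ y a b → (y ^ℚ suc b ≤ᵇ 1ℚ ^ℚ a) ≡ true → y ≤ 1ℚ
^≤1⇒≤1 y a b eq = [ (λ y≤1 → y≤1) , (λ 1≤y → ℚ.≤-trans (p≤p^suc b 1≤y)
  (ℚ.≤-trans (ℚ.≤ᵇ⇒≤ (Equivalence.from Bool.T-≡ eq)) (ℚ.≤-reflexive (1^ a)))) ]′ (ℚ.≤-total y 1ℚ)

0/N≤1 : ∀ N .{{_ : ℕ.NonZero N}} → + 0 / N ≤ 1ℚ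
0/N≤1 N = ℚ.≤-trans (ℚ.≤-reflexive (ℚ.0/n≡0 N)) 0≤1

greatest-below-1≤1 : ∀ a b N .{{_ : ℕ.NonZero N}} B → + greatest (below a (suc b) 1ℚ N) B / N ≤ 1ℚ
greatest-below-1≤1 a b N B = [ (λ j≡0 → subst (λ j → + j / N ≤ 1ℚ) (sym j≡0) (0/N≤1 N)) ,
    ^≤1⇒≤1 (+ greatest (below a (suc b) 1ℚ N) B / N) a b ]′
  (greatest-satisfies (below a (suc b) 1ℚ N) B)

ι≤rationalPower : ∀ x q N .{{_ : ℕ.NonZero N}} c → ι c ^ℚ ↧ₙ q ≤ x ^ℚ ℤ.∣ ↥ q ∣ →
  c ℕ.≤ (1 ℕ.+ ℤ.∣ ↥ x ∣) ℕ.^ ℤ.∣ ↥ q ∣ → ι c ≤ rationalPower x q N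
ι≤rationalPower x q N c c^b≤x^a c≤ = ≤greatest-below ℤ.∣ ↥ q ∣ (↧ₙ q) x N c c^b≤x^a
  (subst (λ z → z ℕ.≤ N ℕ.* (1 ℕ.+ ℤ.∣ ↥ x ∣) ℕ.^ ℤ.∣ ↥ q ∣) (ℕ.*-comm N c) (ℕ.*-monoʳ-≤ N c≤))

-- Together with the converse bound below: a degree 1 has power exactly 1 at every index, without
-- passing to the limit.
rationalPower-1≤1 : ∀ q N .{{_ : ℕ.NonZero N}} → rationalPower 1ℚ q N ≤ 1ℚ
rationalPower-1≤1 q N = greatest-below-1≤1 ℤ.∣ ↥ q ∣ (ℚ.denominator-1 q) N (N ℕ.* 2 ℕ.^ ℤ.∣ ↥ q ∣)

1≤rationalPower-1 : ∀ q N .{{_ : ℕ.NonZero N}} → 1ℚ ≤ rationalPower 1ℚ q N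
1≤rationalPower-1 q N = subst (λ z → z ≤ rationalPower 1ℚ q N) (ι-def 1) (ι≤rationalPower 1ℚ q N 1
  (ℚ.≤-reflexive (trans (cong (_^ℚ ↧ₙ q) (ι-def 1)) (trans (1^ (↧ₙ q)) (sym (1^ ℤ.∣ ↥ q ∣)))))
  (ℕ.m^n>0 2 ℤ.∣ ↥ q ∣))

i≤∣i∣ : ∀ i → i ℤ.≤ + ℤ.∣ i ∣
i≤∣i∣ (+ n)    = ℤ.≤-refl
i≤∣i∣ -[1+ n ] = ℤ.-≤+

*↧≤∣↥∣* : ∀ c d q → mkℚᵘ (+ c) d ℚᵘ.≤ toℚᵘ q → c ℕ.* ↧ₙ q ℕ.≤ ℤ.∣ ↥ q ∣ ℕ.* suc d
*↧≤∣↥∣* c d (mkℚ n d′ _) (ℚᵘ.*≤* h) = ℤ.drop‿+≤+ (ℤ.≤-trans (ℤ.≤-reflexive (ℤ.pos-* c (suc d′)))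
  (ℤ.≤-trans h (ℤ.≤-trans (ℤ.*-monoʳ-≤-nonNeg (+ suc d) (i≤∣i∣ n)) (ℤ.≤-reflexive (sym (ℤ.pos-* ℤ.∣ n ∣ (suc d)))))))

-- With q = a / b ≥ 1 / (k + 1) we have b ≤ a (k + 1), so K ^ b ≤ (K ^ (k + 1)) ^ a.
ι≤rationalPower-large : ∀ {x q} k K N .{{_ : ℕ.NonZero N}} .{{_ : ℕ.NonZero K}} → 1/suc k ≤ q → ι (K ℕ.^ suc k) ≤ x →
  ι K ≤ rationalPower x q N
ι≤rationalPower-large {x} {q} k K N 1/k≤q R≤x = ι≤rationalPower x q N K K^b≤x^a K≤
  where
  a b R : ℕ
  a = ℤ.∣ ↥ q ∣
  b = ↧ₙ q
  R = K ℕ.^ suc k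

  b≤a[1+k] : b ℕ.≤ a ℕ.* suc k
  b≤a[1+k] = subst (ℕ._≤ a ℕ.* suc k) (ℕ.*-identityˡ b)
    (*↧≤∣↥∣* 1 k q (ℚᵘ.≤-respˡ-≃ (ℚ.toℚᵘ-fromℚᵘ (mkℚᵘ (+ 1) k)) (ℚ.toℚᵘ-mono-≤ 1/k≤q)))

  1≤a : 1 ℕ.≤ a
  1≤a = ℕ.n≢0⇒n>0 λ a≡0 → ℕ.<⇒≱ (ℕ.s≤s ℕ.z≤n) (subst (λ z → b ℕ.≤ z ℕ.* suc k) a≡0 b≤a[1+k])

  K^b≤x^a : ι K ^ℚ b ≤ x ^ℚ a
  K^b≤x^a = begin
    ι K ^ℚ b                  ≡⟨ ι-^ K b ⟩
    ι (K ℕ.^ b)               ≤⟨ ι-mono (ℕ.^-monoʳ-≤ K b≤a[1+k]) ⟩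
    ι (K ℕ.^ (a ℕ.* suc k))   ≡⟨ cong (λ z → ι (K ℕ.^ z)) (ℕ.*-comm a (suc k)) ⟩
    ι (K ℕ.^ (suc k ℕ.* a))   ≡⟨ cong ι (ℕ.^-*-assoc K (suc k) a) ⟨
    ι (R ℕ.^ a)               ≡⟨ ι-^ R a ⟨
    ι R ^ℚ a                  ≤⟨ ^-mono-≤ a (0≤ι R) R≤x ⟩
    x ^ℚ a                    ∎
    where open ≤-Reasoning

  -- The search range of `rationalPower` is given by the numerator of x, so K must also be shown to
  -- lie within it; x ≥ R forces a numerator of at least R ≥ K.
  R≤∣↥x∣ : R ℕ.≤ ℤ.∣ ↥ x ∣
  R≤∣↥x∣ = ℕ.≤-trans (ℕ.m≤m*n R (↧ₙ x)) (subst (R ℕ.* ↧ₙ x ℕ.≤_) (ℕ.*-identityʳ ℤ.∣ ↥ x ∣)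
    (*↧≤∣↥∣* R 0 x (ℚᵘ.≤-respˡ-≃ (ι≡ R) (ℚ.toℚᵘ-mono-≤ R≤x))))

  K≤ : K ℕ.≤ (1 ℕ.+ ℤ.∣ ↥ x ∣) ℕ.^ a
  K≤ = begin
    K                         ≡⟨ ℕ.^-identityʳ K ⟨
    K ℕ.^ 1                   ≤⟨ ℕ.^-monoʳ-≤ K {1} {suc k} (ℕ.s≤s ℕ.z≤n) ⟩
    R                         ≤⟨ R≤∣↥x∣ ⟩
    ℤ.∣ ↥ x ∣                 ≤⟨ ℕ.n≤1+n _ ⟩
    1 ℕ.+ ℤ.∣ ↥ x ∣           ≡⟨ ℕ.^-identityʳ _ ⟨
    (1 ℕ.+ ℤ.∣ ↥ x ∣) ℕ.^ 1   ≤⟨ ℕ.^-monoʳ-≤ (1 ℕ.+ ℤ.∣ ↥ x ∣) 1≤a ⟩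
    (1 ℕ.+ ℤ.∣ ↥ x ∣) ℕ.^ a   ∎
    where open ℕ.≤-Reasoning

-- From conditional to unconditional sampling probabilities

÷ᴿ-* : ∀ x y m → 0ℚ < y m → (x ÷ᴿ y) m * y m ≡ x m
÷ᴿ-* x y m 0<y with y m ℚ.≟ 0ℚ
... | yes y≡0 = ⊥-elim (ℚ.<-irrefl (sym y≡0) 0<y)
... | no  y≢0 = trans (ℚ.*-assoc (x m) _ (y m))
    (trans (cong (λ z → x m * z) (ℚ.*-inverseˡ (y m) {{≢-nonZero y≢0}})) (ℚ.*-identityʳ (x m)))

÷ᴿ-bounds : ∀ x y m {τ} → 0ℚ < y m → 0ℚ ≤ x m → x m ≤ τ * y m → 0ℚ ≤ (x ÷ᴿ y) m × (x ÷ᴿ y) m ≤ τ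
÷ᴿ-bounds x y m {τ} 0<y 0≤x x≤τy =
  cancel (subst₂ _≤_ (sym (ℚ.*-zeroˡ (y m))) (sym (÷ᴿ-* x y m 0<y)) 0≤x) ,
  cancel (subst (_≤ τ * y m) (sym (÷ᴿ-* x y m 0<y)) x≤τy)
  where
  cancel : ∀ {p q} → p * y m ≤ q * y m → p ≤ q
  cancel = ℚ.*-cancelʳ-≤-pos (y m) {{positive 0<y}}

-- The factor 2 absorbs 1 + ε ≤ 19 / 10 and a failure probability which is
-- nonnegative only in the limit.
sampled-≼ : ∀ {ε hit fail target : Seq} {τ} → ε <ᴿ const (+ 9 / 10) →
  const 0ℚ ≼ fail → fail ≼ const (+ 49 / 100) →
  hit ÷ᴿ (const 1ℚ -ᴿ fail) ≼ (const 1ℚ +ᴿ ε) *ᴿ target →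
  ∀∞ (λ m → 0ℚ ≤ target m × target m ≤ τ) → hit ≼ const (+ 2 / 1 * τ)
sampled-≼ {ε} {hit} {fail} {target} {τ} (k , ε<) 0≼fail fail≼ cond≼ target≤ = ≼-intro λ e 0<e →
  ∀∞-map₂ (λ { m (a , b) ((c , d) , (t , u)) → main m e (ℚ.<⇒≤ 0<e) a b c d t u })
    -- The tolerance 1/19 gives 1 - fail ≤ 20/19, and 19/10 * 20/19 = 2. The tolerance 1/100 for the
    -- upper bound on fail keeps 1 - fail at least 1/2, so the division is genuine.
    (∀∞-× ε< (within 0≼fail (+ 1 / 19) (0<1/suc 18)))
    (∀∞-× (∀∞-× (within fail≼ (+ 1 / 100) (0<1/suc 99)) (within cond≼ (½ * e) (0<½* 0<e))) target≤)
  where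
  main : ∀ m e → 0ℚ ≤ e → ε m + 1/suc k ≤ + 9 / 10 → 0ℚ ≤ fail m + + 1 / 19 → fail m ≤ + 49 / 100 + + 1 / 100 →
    (hit ÷ᴿ (const 1ℚ -ᴿ fail)) m ≤ (1ℚ + ε m) * target m + ½ * e → 0ℚ ≤ target m → target m ≤ τ →
    hit m ≤ + 2 / 1 * τ + e
  main m e 0≤e ε< f≥ f≤ c≤ 0≤t t≤τ = subst (_≤ + 2 / 1 * τ + e) (÷ᴿ-* hit (const 1ℚ -ᴿ fail) m 0<g)
    (ℚ.≤-trans (ℚ.*-monoʳ-≤-nonNeg g {{nonNegative (ℚ.<⇒≤ 0<g)}} (ℚ.≤-trans c≤ bound))
      (≤-by ((+ 19 / 10 * τ + ½ * e) * (fail m + + 1 / 19) + + 9 / 19 * e)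
        (0≤+ (0≤* (0≤+ (0≤* (0≤/ 19 10) (ℚ.≤-trans 0≤t t≤τ)) (0≤* (0≤/ 1 2) 0≤e)) f≥) (0≤* (0≤/ 9 19) 0≤e))
        (solve 3 (λ τ e f → (con (+ 19 / 10) :* τ :+ con ½ :* e) :* (con 1ℚ :- f)
            :+ ((con (+ 19 / 10) :* τ :+ con ½ :* e) :* (f :+ con (+ 1 / 19)) :+ con (+ 9 / 19) :* e) := con (+ 2 / 1) :* τ :+ e) refl τ e (fail m))))
    where
    g : ℚ
    g = 1ℚ - fail m
    0<g : 0ℚ < g
    0<g = ℚ.<-≤-trans (ℚ.positive⁻¹ ½) (≤-by _ (0≤- f≤)
      (solve 1 (λ f → con ½ :+ (con (+ 49 / 100) :+ con (+ 1 / 100) :- f) := con 1ℚ :- f) refl (fail m)))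
    bound : (1ℚ + ε m) * target m + ½ * e ≤ + 19 / 10 * τ + ½ * e
    bound = ≤-by ((+ 9 / 10 - (ε m + 1/suc k) + 1/suc k) * target m + + 19 / 10 * (τ - target m))
      (0≤+ (0≤* (0≤+ (0≤- ε<) (ℚ.<⇒≤ (0<1/suc k))) 0≤t) (0≤* (0≤/ 19 10) (0≤- t≤τ)))
      (solve 5 (λ ε t τ e s → (con 1ℚ :+ ε) :* t :+ con ½ :* e :+ ((con (+ 9 / 10) :- (ε :+ s) :+ s) :* t :+ con (+ 19 / 10) :* (τ :- t))
          := con (+ 19 / 10) :* τ :+ con ½ :* e) refl (ε m) (target m) τ e (1/suc k))

-- Indicators, finite sums and 0-1 similarities

bit : Bool → ℚ
bit b = if b then 1ℚ else 0ℚ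

0≤bit : ∀ b → 0ℚ ≤ bit b
0≤bit true  = 0≤1
0≤bit false = ℚ.≤-refl

bit≤1 : ∀ b → bit b ≤ 1ℚ
bit≤1 true  = ℚ.≤-refl
bit≤1 false = 0≤1

bit-mono : ∀ {a b} → (a ≡ true → b ≡ true) → bit a ≤ bit b
bit-mono {false} {b}     h = 0≤bit b
bit-mono {true}  {true}  h = ℚ.≤-refl
bit-mono {true}  {false} h with () ← h refl

same : ∀ {n} → Fin n → Fin n → Bool
same i j = ⌊ i Fin.≟ j ⌋

same-refl : ∀ {n} (i : Fin n) → same i i ≡ true
same-refl i with i Fin.≟ i
... | yes _  = refl
... | no i≢i = ⊥-elim (i≢i refl)

same⇒≡ : ∀ {n} (i j : Fin n) → same i j ≡ true → i ≡ j
same⇒≡ i j eq with i Fin.≟ j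
... | yes i≡j = i≡j
same⇒≡ i j () | no _

same-sym : ∀ {n} (i j : Fin n) → same i j ≡ same j i
same-sym i j with i Fin.≟ j
... | yes refl = sym (same-refl i)
... | no i≢j with j Fin.≟ i
...   | yes j≡i = ⊥-elim (i≢j (sym j≡i))
...   | no _    = refl

same-suc : ∀ {n} (i j : Fin n) → same (suc i) (suc j) ≡ same i j
same-suc i j with i Fin.≟ j
... | yes _ = refl
... | no _  = refl

sum-same : ∀ {n} (j : Fin n) → sum (λ i → bit (same j i)) ≡ 1ℚ
sum-same {suc n} zero = trans (cong (λ z → 1ℚ + z) (Sum.sum-replicate-zero n)) refl
sum-same {suc n} (suc j) = trans (ℚ.+-identityˡ _)
  (trans (Sum.sum-cong-≗ λ i → cong bit (same-suc j i)) (sum-same j))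

sum-↑ : ∀ a b (f : Fin (a ℕ.+ b) → ℚ) → sum f ≡ sum (λ i → f (i ↑ˡ b)) + sum (λ i → f (a ↑ʳ i))
sum-↑ zero    b f = sym (ℚ.+-identityˡ (sum f))
sum-↑ (suc a) b f = trans (cong (λ z → f zero + z) (sum-↑ a b (f ∘ suc))) (sym (ℚ.+-assoc (f zero) _ _))

sum-combine : ∀ a b (f : Fin (a ℕ.* b) → ℚ) → sum f ≡ sum {a} (λ i → sum {b} (λ l → f (combine i l)))
sum-combine zero    b f = refl
sum-combine (suc a) b f = trans (sum-↑ b (a ℕ.* b) f) (cong (λ z → sum (λ l → f (l ↑ˡ (a ℕ.* b))) + z) (sum-combine a b (λ i → f (b ↑ʳ i))))

constℝ : ℚ → ℝ
constℝ q .seq = const q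
constℝ q .cauchy k = 0 , λ _ _ _ _ → subst (_≤ 1/suc k) (cong ∣_∣ (sym (ℚ.+-inverseʳ q))) (ℚ.<⇒≤ (0<1/suc k))

const-mono : ∀ {p q} → p ≤ q → const p ≤ᴿ const q
const-mono {p} {q} p≤q k = 0 , λ _ _ → ℚ.≤-trans p≤q (≤-by (1/suc k) (ℚ.<⇒≤ (0<1/suc k)) refl)

indicatorSimilarity : ∀ {u} (related : Fin u → Fin u → Bool) →
  (∀ x y → related x y ≡ related y x) → (∀ x → related x x ≡ true) → Similarity u
indicatorSimilarity related related-sym related-refl = record
  { f         = λ x y → constℝ (bit (related x y))
  ; nonneg    = λ x y → const-mono (0≤bit (related x y))
  ; atMostOne = λ x y → const-mono (bit≤1 (related x y))
  ; symmetric = λ x y → const-mono (ℚ.≤-reflexive (cong bit (related-sym x y))) ,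
                        const-mono (ℚ.≤-reflexive (cong bit (related-sym y x)))
  ; self      = λ x → const-mono (ℚ.≤-reflexive (cong bit (related-refl x))) ,
                      const-mono (ℚ.≤-reflexive (cong bit (sym (related-refl x))))
  }

-- The hard streams and their degrees

-- An item is a position together with a label.  The label of a node of block i is
-- suc i if the bit i is set, and zero otherwise; the last m positions carry the
-- label suc j to query the bit j.  Items at positions of different kind are
-- similar when they share a label other than zero.
module Instance (k r m : ℕ) where

  n : ℕ
  n = k ℕ.* r ℕ.+ m

  part : Fin n → Fin (k ℕ.* r) ⊎ Fin m
  part = splitAt (k ℕ.* r)

  Label : Set
  Label = Fin (suc k)

  side : Fin (k ℕ.* r) ⊎ Fin m → Bool
  side (inj₁ _) = true
  side (inj₂ _) = false

  marked : Label → Bool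
  marked zero    = false
  marked (suc _) = true

  adjacent : Fin n × Label → Fin n × Label → Bool
  adjacent (i , a) (i′ , a′) = same a a′ ∧ (same i i′ ∨ (marked a ∧ (side (part i) xor side (part i′))))

  adjacent-sym : ∀ v w → adjacent v w ≡ adjacent w v
  adjacent-sym (i , a) (i′ , a′) with a Fin.≟ a′
  ... | yes refl = trans (cong₂ _∨_ (same-sym i i′) (cong (marked a ∧_) (Bool.xor-comm (side (part i)) (side (part i′)))))
    (cong (_∧ (same i′ i ∨ (marked a ∧ (side (part i′) xor side (part i))))) (sym (same-refl a)))
  ... | no a≢a′ with a′ Fin.≟ a
  ...   | yes a′≡a = ⊥-elim (a≢a′ (sym a′≡a))
  ...   | no _     = refl

  adjacent-refl : ∀ v → adjacent v v ≡ true
  adjacent-refl (i , a) rewrite same-refl a | same-refl i = refl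

  -- One similarity for all strings and queries: they enter only through the stream, so machine and
  -- memory size are the same throughout.
  F : Similarity (n ℕ.* suc k)
  F = indicatorSimilarity (λ x y → adjacent (remQuot {n} (suc k) x) (remQuot {n} (suc k) y))
    (λ x y → adjacent-sym (remQuot {n} (suc k) x) (remQuot {n} (suc k) y)) (λ x → adjacent-refl (remQuot {n} (suc k) x))

  bitLabel : Vec Bool k → Fin (k ℕ.* r) → Label
  bitLabel x a = if lookup x (quotient {k} r a) then suc (quotient {k} r a) else zero

  label : Vec Bool k → Fin k → Fin (k ℕ.* r) ⊎ Fin m → Label
  label x j (inj₁ a) = bitLabel x a
  label x j (inj₂ _) = suc j

  σ : Vec Bool k → Fin k → Stream n (n ℕ.* suc k)
  σ x j i = combine i (label x j (part i))

  inBlock : Fin k → Fin (k ℕ.* r) ⊎ Fin m → Bool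
  inBlock j (inj₁ a) = same (quotient {k} r a) j
  inBlock j (inj₂ _) = false

  -- Sampling one of these nodes is read as the answer that the bit j is set.
  concerned : Fin k → Fin (k ℕ.* r) ⊎ Fin m → Bool
  concerned j (inj₁ a) = same (quotient {k} r a) j
  concerned j (inj₂ _) = true

  linked : Vec Bool k → Fin k → (v w : Fin (k ℕ.* r) ⊎ Fin m) → Bool
  linked x j v w = same (label x j v) (label x j w) ∧ (marked (label x j v) ∧ (side v xor side w))

  bitLabel≡suc : ∀ x a j → same (bitLabel x a) (suc j) ≡ true → lookup x j ≡ true × quotient {k} r a ≡ j
  bitLabel≡suc x a j eq with lookup x (quotient {k} r a) in eq′
  ... | true with refl ← same⇒≡ (suc (quotient {k} r a)) (suc j) eq = eq′ , refl
  ... | false with () ← same⇒≡ zero (suc j) eq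

  -- A link joins a node of some block to a query, so both carry the label `suc j`. A block node has
  -- this label only if it lies in block j and the bit j is set.
  linked⇒ : ∀ x j v w → linked x j v w ≡ true → lookup x j ≡ true × concerned j v ≡ true
  linked⇒ x j (inj₁ a) (inj₁ b) h with same (bitLabel x a) (bitLabel x b) | marked (bitLabel x a)
  linked⇒ x j (inj₁ a) (inj₁ b) () | true  | true
  linked⇒ x j (inj₁ a) (inj₁ b) () | true  | false
  linked⇒ x j (inj₁ a) (inj₁ b) () | false | _
  linked⇒ x j (inj₂ a) (inj₂ b) h with same (suc j) (suc j)
  linked⇒ x j (inj₂ a) (inj₂ b) () | true
  linked⇒ x j (inj₂ a) (inj₂ b) () | false
  linked⇒ x j (inj₁ a) (inj₂ b) h with same (bitLabel x a) (suc j) in eq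
  ... | true = proj₁ (bitLabel≡suc x a j eq) , subst (λ q → same q j ≡ true) (sym (proj₂ (bitLabel≡suc x a j eq))) (same-refl j)
  linked⇒ x j (inj₂ a) (inj₁ b) h with same (suc j) (bitLabel x b) in eq
  ... | true = proj₁ (bitLabel≡suc x b j (trans (same-sym (bitLabel x b) (suc j)) eq)) , refl

  adjacent-σ : ∀ x j i i′ → seq (Similarity.f F (σ x j i) (σ x j i′)) ≡
    const (bit (adjacent (i , label x j (part i)) (i′ , label x j (part i′))))
  adjacent-σ x j i i′ = cong₂ (λ v w → const (bit (adjacent v w)))
    (Fin.remQuot-combine i (label x j (part i))) (Fin.remQuot-combine i′ (label x j (part i′)))

  unlinked-adjacent : ∀ x j i i′ → (lookup x j ≡ true → concerned j (part i) ≡ true → ⊥) →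
    adjacent (i , label x j (part i)) (i′ , label x j (part i′)) ≡ same i i′
  unlinked-adjacent x j i i′ unlinked with i Fin.≟ i′
  ... | yes refl = trans (Bool.∧-identityʳ _) (same-refl (label x j (part i)))
  ... | no _ with linked x j (part i) (part i′) in eq
  ...   | true  = ⊥-elim (unlinked (proj₁ l) (proj₂ l))
    where l = linked⇒ x j (part i) (part i′) eq
  ...   | false = refl

  -- Only the self-loop contributes.
  degree-unlinked : ∀ x j i m′ → (lookup x j ≡ true → concerned j (part i) ≡ true → ⊥) →
    degree F (σ x j) i m′ ≡ 1ℚ
  degree-unlinked x j i m′ unlinked = trans (Sum.sum-cong-≗ λ i′ →
      trans (cong (λ s → s m′) (adjacent-σ x j i i′)) (cong bit (unlinked-adjacent x j i i′ unlinked)))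
    (sum-same i)

  sum-inBlock : ∀ j → sum (λ i → bit (inBlock j (part i))) ≡ ι r
  sum-inBlock j = begin
    sum (λ i → bit (inBlock j (part i)))
      ≡⟨ sum-↑ (k ℕ.* r) m _ ⟩
    sum (λ a → bit (inBlock j (part (a ↑ˡ m)))) + sum (λ l → bit (inBlock j (part ((k ℕ.* r) ↑ʳ l))))
      ≡⟨ cong₂ _+_ (Sum.sum-cong-≗ λ a → cong (bit ∘ inBlock j) (Fin.splitAt-↑ˡ (k ℕ.* r) a m))
                   (Sum.sum-cong-≗ λ l → cong (bit ∘ inBlock j) (Fin.splitAt-↑ʳ (k ℕ.* r) m l)) ⟩
    sum (λ a → bit (same (quotient {k} r a) j)) + sum {m} (λ _ → 0ℚ)
      ≡⟨ cong₂ _+_ (sum-combine k r _) (Sum.sum-replicate-zero m) ⟩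
    sum {k} (λ i → sum {r} (λ l → bit (same (quotient {k} r (combine i l)) j))) + 0ℚ
      ≡⟨ ℚ.+-identityʳ _ ⟩
    sum {k} (λ i → sum {r} (λ l → bit (same (quotient {k} r (combine i l)) j)))
      ≡⟨ Sum.sum-cong-≗ (λ i → trans (Sum.sum-cong-≗ {r} λ l → cong bit (trans (cong (λ z → same (proj₁ z) j) (Fin.remQuot-combine i l)) (same-sym i j)))
           (sum-const r (bit (same j i)))) ⟩
    sum {k} (λ i → ι r * bit (same j i))
      ≡⟨ Sum.*-distribˡ-sum {k} (ι r) (λ i → bit (same j i)) ⟨
    ι r * sum {k} (λ i → bit (same j i))
      ≡⟨ cong (λ z → ι r * z) (sum-same j) ⟩
    ι r * 1ℚ
      ≡⟨ ℚ.*-identityʳ (ι r) ⟩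
    ι r ∎
    where open ≡-Reasoning

  sum-query : ∀ q → sum (λ i → if side (part i) then 0ℚ else q) ≡ ι m * q
  sum-query q = begin
    sum (λ i → if side (part i) then 0ℚ else q)
      ≡⟨ sum-↑ (k ℕ.* r) m _ ⟩
    sum (λ a → if side (part (a ↑ˡ m)) then 0ℚ else q) + sum (λ l → if side (part ((k ℕ.* r) ↑ʳ l)) then 0ℚ else q)
      ≡⟨ cong₂ _+_ (Sum.sum-cong-≗ λ a → cong (λ z → if side z then 0ℚ else q) (Fin.splitAt-↑ˡ (k ℕ.* r) a m))
                   (Sum.sum-cong-≗ λ l → cong (λ z → if side z then 0ℚ else q) (Fin.splitAt-↑ʳ (k ℕ.* r) m l)) ⟩
    sum {k ℕ.* r} (λ _ → 0ℚ) + sum {m} (λ _ → q)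
      ≡⟨ cong₂ _+_ (Sum.sum-replicate-zero (k ℕ.* r)) (sum-const m q) ⟩
    0ℚ + ι m * q
      ≡⟨ ℚ.+-identityˡ _ ⟩
    ι m * q ∎
    where open ≡-Reasoning

  sum-concerned : ∀ j → sum (λ i → bit (concerned j (part i))) ≡ ι (m ℕ.+ r)
  sum-concerned j = begin
    sum (λ i → bit (concerned j (part i)))
      ≡⟨ Sum.sum-cong-≗ (λ i → split (part i)) ⟩
    sum (λ i → (if side (part i) then 0ℚ else 1ℚ) + bit (inBlock j (part i)))
      ≡⟨ Sum.∑-distrib-+ (λ i → if side (part i) then 0ℚ else 1ℚ) (λ i → bit (inBlock j (part i))) ⟩
    sum (λ i → if side (part i) then 0ℚ else 1ℚ) + sum (λ i → bit (inBlock j (part i)))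
      ≡⟨ cong₂ _+_ (trans (sum-query 1ℚ) (ℚ.*-identityʳ (ι m))) (sum-inBlock j) ⟩
    ι m + ι r
      ≡⟨ ι-+ m r ⟨
    ι (m ℕ.+ r) ∎
    where
    open ≡-Reasoning
    split : ∀ v → bit (concerned j v) ≡ (if side v then 0ℚ else 1ℚ) + bit (inBlock j v)
    split (inj₁ a) = sym (ℚ.+-identityˡ _)
    split (inj₂ _) = sym (ℚ.+-identityʳ 1ℚ)

  query-adjacent : ∀ x j i i′ → lookup x j ≡ true → side (part i) ≡ false →
    inBlock j (part i′) ≡ true →
    adjacent (i , label x j (part i)) (i′ , label x j (part i′)) ≡ true
  query-adjacent x j i i′ x[j] query block with part i | part i′
  query-adjacent x j i i′ x[j] refl block | inj₂ l | inj₁ a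
    with refl ← same⇒≡ (quotient {k} r a) j block rewrite x[j] | same-refl (suc (quotient {k} r a)) = Bool.∨-zeroʳ (same i i′)

  -- The query is similar to each of the r nodes of block j.
  degree-query : ∀ x j i m′ → lookup x j ≡ true → side (part i) ≡ false →
    ι r ≤ degree F (σ x j) i m′
  degree-query x j i m′ x[j] query = subst (_≤ degree F (σ x j) i m′) (sum-inBlock j)
    (sum-mono λ i′ → subst (λ s → bit (inBlock j (part i′)) ≤ s m′) (sym (adjacent-σ x j i i′)) (bit-mono (query-adjacent x j i i′ x[j] query)))

true≢false : true ≢ false
true≢false ()

tabulate-+ : ∀ {X : Set} a b (f : Fin (a ℕ.+ b) → X) →
  tabulate f ≡ tabulate (λ i → f (i ↑ˡ b)) ++ tabulate (λ i → f (a ↑ʳ i))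
tabulate-+ zero    b f = refl
tabulate-+ (suc a) b f = cong (f zero ∷_) (tabulate-+ a b (f ∘ suc))

-- Target probabilities of misleading nodes

module Targets (k r m K k₀ : ℕ) .{{_ : ℕ.NonZero K}} (K^≤r : K ℕ.^ suc k₀ ℕ.≤ r)
  {{_ : ℕ.NonZero (k ℕ.* r ℕ.+ m)}} {{_ : ℕ.NonZero (m ℕ.* K)}} (p : Seq) where
  open Instance k r m

  -- Lower bounds for the moment by the value of the queried bit: if it is not set, all n degrees
  -- are 1; if it is set, each of the m queries contributes at least K.
  momentBound : Bool → ℕ
  momentBound false = n
  momentBound true  = m ℕ.* K

  momentBound≢0 : ∀ c → ℕ.NonZero (momentBound c)
  momentBound≢0 false = ℕ.≢-nonZero (ℕ.≢-nonZero⁻¹ (k ℕ.* r ℕ.+ m))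
  momentBound≢0 true  = ℕ.≢-nonZero (ℕ.≢-nonZero⁻¹ (m ℕ.* K))

  share : Bool → ℚ
  share c = _/_ (+ 1) (momentBound c) {{momentBound≢0 c}}

  module _ (x : Vec Bool k) (j : Fin k) (t : ℕ) (1/k₀≤p : 1/suc k₀ ≤ p t) where
    power : Fin n → ℚ
    power i = (degree F (σ x j) i ^ᴿ p) t

    0≤power : ∀ i → 0ℚ ≤ power i
    0≤power i = 0≤rationalPower (degree F (σ x j) i t) (p t) (suc t)

    -- Nodes suggesting the wrong answer have degree 1 in both cases: with the bit set they are not
    -- concerned, and with the bit unset no node is linked at all.
    unlinked : ∀ i → concerned j (part i) ≡ not (lookup x j) →
      lookup x j ≡ true → concerned j (part i) ≡ true → ⊥
    unlinked i wrong x[j] conc with () ← trans (sym conc) (trans wrong (cong not x[j]))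

    power≤1 : ∀ i → concerned j (part i) ≡ not (lookup x j) → power i ≤ 1ℚ
    power≤1 i wrong = subst (λ d → rationalPower d (p t) (suc t) ≤ 1ℚ) (sym (degree-unlinked x j i t (unlinked i wrong)))
      (rationalPower-1≤1 (p t) (suc t))

    moment≥ : ∀ c → lookup x j ≡ c → ι (momentBound c) ≤ moment F (σ x j) p t
    moment≥ false x[j] = subst (_≤ moment F (σ x j) p t) (trans (sum-const n 1ℚ) (ℚ.*-identityʳ (ι n)))
      (sum-mono λ i → subst (λ d → 1ℚ ≤ rationalPower d (p t) (suc t))
        (sym (degree-unlinked x j i t (λ x[j]′ _ → true≢false (trans (sym x[j]′) x[j])))) (1≤rationalPower-1 (p t) (suc t)))
    moment≥ true x[j] = subst (_≤ moment F (σ x j) p t) (trans (sum-query (ι K)) (sym (ι-* m K)))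
      (sum-mono λ i → at i (side (part i)) refl)
      where
      at : ∀ i b → side (part i) ≡ b → (if b then 0ℚ else ι K) ≤ power i
      at i true  _     = 0≤power i
      at i false query = ι≤rationalPower-large k₀ K (suc t) 1/k₀≤p
        (ℚ.≤-trans (ι-mono K^≤r) (degree-query x j i t x[j] query))

    target-bounds : ∀ i c → lookup x j ≡ c → concerned j (part i) ≡ not c →
      0ℚ ≤ target p F (σ x j) i t × target p F (σ x j) i t ≤ share c
    target-bounds i c x[j] wrong = ÷ᴿ-bounds (degree F (σ x j) i ^ᴿ p) (moment F (σ x j) p) t
      (ℚ.<-≤-trans (0<ι′ (momentBound c) {{momentBound≢0 c}}) (moment≥ c x[j])) (0≤power i)
      (ℚ.≤-trans (power≤1 i (trans wrong (cong not (sym x[j])))) (ℚ.≤-trans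
        (ℚ.≤-reflexive (sym (trans (/-*-ι 1 (momentBound c) {{momentBound≢0 c}}) (ι-def 1))))
        (ℚ.*-monoˡ-≤-nonNeg (share c) {{nonNegative (0≤/ 1 (momentBound c) {{momentBound≢0 c}})}} (moment≥ c x[j]))))
      where
      0<ι′ : ∀ L .{{_ : ℕ.NonZero L}} → 0ℚ < ι L
      0<ι′ (suc L) = 0<ι L

-- The one-way protocol built from a sampler

agree : Bool → Bool → Bool
agree true  b = b
agree false b = not b

bit-agree : ∀ c b → bit (agree c b) + bit (agree (not c) b) ≡ 1ℚ
bit-agree true  true  = ℚ.+-identityʳ 1ℚ
bit-agree true  false = ℚ.+-identityˡ 1ℚ
bit-agree false true  = ℚ.+-identityˡ 1ℚ
bit-agree false false = ℚ.+-identityʳ 1ℚ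

agree⇒≡ : ∀ c b → agree c b ≡ true → b ≡ c
agree⇒≡ true  true  _ = refl
agree⇒≡ false false _ = refl

bit-≼ : ∀ b {x q} → 0ℚ ≤ q → (b ≡ true → x ≼ const q) → const (bit b) *ᴿ x ≼ const (bit b * q)
bit-≼ true  {x} {q} 0≤q h = ≼-trans (≼-reflexive λ m → ℚ.*-identityˡ (x m)) (≼-trans (h refl) (≼-reflexive λ m → sym (ℚ.*-identityˡ q)))
bit-≼ false {x} {q} 0≤q h = ≼-reflexive λ m → trans (ℚ.*-zeroˡ (x m)) (sym (ℚ.*-zeroˡ q))

module Protocol (κ r m K k₀ : ℕ) .{{_ : ℕ.NonZero K}} (K^≤r : K ℕ.^ suc k₀ ℕ.≤ r)
  {{_ : ℕ.NonZero (10 ℕ.* κ ℕ.* r ℕ.+ m)}} {{_ : ℕ.NonZero (m ℕ.* K)}}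
  (few-concerned : 400 ℕ.* (m ℕ.+ r) ℕ.≤ 10 ℕ.* κ ℕ.* r ℕ.+ m) (many-queries : 400 ℕ.* (10 ℕ.* κ ℕ.* r ℕ.+ m) ℕ.≤ m ℕ.* K)
  (p ε : Seq) (1/k₀≤p : ∀∞ λ t → 1/suc k₀ ≤ p t) (ε< : ε <ᴿ const (+ 9 / 10))
  (A : OnePassAlgorithm (10 ℕ.* κ ℕ.* r ℕ.+ m)) (sampler : IsSampler ε (const (+ 49 / 100)) p A) where

  private
    k : ℕ
    k = 10 ℕ.* κ

  open Instance (10 ℕ.* κ) r m
  open Targets (10 ℕ.* κ) r m K k₀ K^≤r p

  private
    M : Machine n (n ℕ.* suc k) (OnePassAlgorithm.space A F)
    M = OnePassAlgorithm.machine A F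

  open Machine M

  Output : Set
  Output = Maybe (Node n (n ℕ.* suc k))

  -- The prefix depends on x alone, and the continuation `queried` on j alone.
  stored : Vec Bool k → List (Node n (n ℕ.* suc k))
  stored x = tabulate λ a → a ↑ˡ m , combine (a ↑ˡ m) (bitLabel x a)

  queried : Fin k → List (Node n (n ℕ.* suc k))
  queried j = tabulate λ l → (k ℕ.* r) ↑ʳ l , combine {n} ((k ℕ.* r) ↑ʳ l) (suc j)

  stream≡ : ∀ x j → tabulate (λ i → i , σ x j i) ≡ stored x ++ queried j
  stream≡ x j = trans (tabulate-+ (k ℕ.* r) m (λ i → i , σ x j i)) (cong₂ _++_
    (List.tabulate-cong λ a → cong (λ v → a ↑ˡ m , combine (a ↑ˡ m) (label x j v)) (Fin.splitAt-↑ˡ (k ℕ.* r) a m))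
    (List.tabulate-cong λ l → cong (λ v → (k ℕ.* r) ↑ʳ l , combine {n} ((k ℕ.* r) ↑ʳ l) (label x j v)) (Fin.splitAt-↑ʳ (k ℕ.* r) m l)))

  store : Vec Bool k → (State → Seq) → Seq
  store x g = 𝔼 init (𝔼-scan M (stored x) g)

  query : Fin k → (Output → Seq) → State → Seq
  query j φ = 𝔼-scan M (queried j) λ t → 𝔼 (output t) φ

  store-isExpectation : ∀ x → IsExpectation (store x)
  store-isExpectation x = ∘-isExpectation (𝔼-isExpectation init) (𝔼-scan-isExpectation M (stored x))

  query-isExpectation : ∀ j t → IsExpectation (λ φ → query j φ t)
  query-isExpectation j t = ∘-isExpectation (𝔼-scan-isExpectation M (queried j) t) (λ t′ → 𝔼-isExpectation (output t′))

  run : Vec Bool k → Fin k → (Output → Seq) → Seq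
  run x j φ = store x (query j φ)

  run-isExpectation : ∀ x j → IsExpectation (run x j)
  run-isExpectation x j = ∘-isExpectation (store-isExpectation x) (query-isExpectation j)

  is : Output → Output → ℚ
  is o o′ = bit ⌊ _≟ₒ_ M o′ o ⌋

  Pr≡run : ∀ x j o t → Pr[_outputs_] M (σ x j) o t ≡ run x j (λ o′ → const (is o o′)) t
  Pr≡run x j o t = IsExpectation.congᴱ (𝔼-isExpectation init)
    {𝔼-scan M (tabulate λ i → i , σ x j i) final} {𝔼-scan M (stored x) (𝔼-scan M (queried j) final)} t
    λ s → trans (cong (λ vs → 𝔼-scan M vs final s t) (stream≡ x j)) (𝔼-scan-++ M (stored x) (queried j) final s t)
    where
    final : State → Seq
    final s = 𝔼 (output s) λ o′ → const (is o o′)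

  -- The answer is decoded from the position only; a failure counts as neither answer.
  answers : Bool → Fin k → Output → Bool
  answers c j nothing        = false
  answers c j (just (i , _)) = agree c (concerned j (part i))

  answerProbability : Bool → Fin k → State → Seq
  answerProbability c j = query j λ o → const (bit (answers c j o))

  answer-nonneg : ∀ c j t → Nonneg (answerProbability c j t)
  answer-nonneg c j t = preserves (query-isExpectation j t) λ o → nonneg-const (0≤bit (answers c j o))

  answers-≤1 : ∀ j o → bit (answers true j o) + bit (answers false j o) ≤ 1ℚ
  answers-≤1 j nothing        = 0≤1
  answers-≤1 j (just (i , _)) = ℚ.≤-reflexive (bit-agree true (concerned j (part i)))

  answer-≼1 : ∀ j t → answerProbability true j t +ᴿ answerProbability false j t ≼ const 1ℚ
  answer-≼1 j t = ≼-trans (≼-reflexive λ m′ → sym (+-homo E (λ o → const (bit (answers true j o))) (λ o → const (bit (answers false j o))) m′))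
      (≼-trans (mono E {λ o → const (bit (answers true j o)) +ᴿ const (bit (answers false j o))} λ o → nonneg-const (0≤- (answers-≤1 j o))) (P1≼1 E))
    where E = query-isExpectation j t

  module _ (x : Vec Bool k) (j : Fin k) where
    private
      E : IsExpectation (run x j)
      E = run-isExpectation x j

      c : Bool
      c = lookup x j

      fail : Seq
      fail = failure A F (σ x j)

      hits : Fin n → Seq
      hits = hit A F (σ x j)

      C : Fin n → Bool
      C i = concerned j (part i)

      rightBit wrongBit : Fin n → ℚ
      rightBit i = bit (agree c (C i))
      wrongBit i = bit (agree (not c) (C i))

      probability : Bool → Seq
      probability b = store x (answerProbability b j)

    fail≼ : fail ≼ const (+ 49 / 100)
    fail≼ = from-≤ᴿ {fail} {const (+ 49 / 100)} (proj₁ (sampler F (σ x j)))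

    1≼fail+hits : const 1ℚ ≼ fail +ᴿ ∑ hits
    1≼fail+hits = from-≤ᴿ {const 1ℚ} {fail +ᴿ ∑ hits} (proj₂ (proj₁ (proj₂ (sampler F (σ x j)))))

    0≼fail : const 0ℚ ≼ fail
    0≼fail = ≼-trans (0≼ (preserves E λ o → nonneg-const (0≤bit ⌊ _≟ₒ_ M o nothing ⌋)))
      (≼-reflexive λ t → sym (Pr≡run x j nothing t))

    0≤share : 0ℚ ≤ share c
    0≤share = 0≤/ 1 (momentBound c) {{momentBound≢0 c}}

    wrong-hit : ∀ i → C i ≡ not c → hits i ≼ const (+ 2 / 1 * share c)
    wrong-hit i wrong = sampled-≼ {ε} {hits i} {fail} {target p F (σ x j) i} ε< 0≼fail
      fail≼ (from-≤ᴿ {conditional A F (σ x j) i} {(const 1ℚ +ᴿ ε) *ᴿ target p F (σ x j) i} (proj₂ (proj₂ (proj₂ (sampler F (σ x j))) i)))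
      (∀∞-map (λ t 1/k₀≤pt → target-bounds x j t 1/k₀≤pt i c refl wrong) 1/k₀≤p)

    -- A union bound over the misleading nodes, each hit with probability at most 2 * share: m + r
    -- nodes against n for an unset bit, at most n nodes against m K for a set one. The factor 400
    -- is 2 * 200.
    wrong-share : ∀ b → lookup x j ≡ b → sum (λ i → bit (agree (not b) (C i))) * (+ 2 / 1 * share b) ≤ + 1 / 200
    wrong-share b eq = begin
      S * (+ 2 / 1 * share b)                     ≡⟨ solve 2 (λ s q → s :* (con (+ 2 / 1) :* q) := con (+ 1 / 200) :* (con (+ 400 / 1) :* s :* q)) refl S (share b) ⟩
      + 1 / 200 * (+ 400 / 1 * S * share b)       ≤⟨ ℚ.*-monoˡ-≤-nonNeg (+ 1 / 200) (ℚ.*-monoʳ-≤-nonNeg (share b) {{nonNegative (0≤/ 1 (momentBound b) {{momentBound≢0 b}})}} (few b)) ⟩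
      + 1 / 200 * (ι (momentBound b) * share b)   ≡⟨ cong (λ z → + 1 / 200 * z) (trans (ℚ.*-comm (ι (momentBound b)) (share b)) (trans (/-*-ι 1 (momentBound b) {{momentBound≢0 b}}) (ι-def 1))) ⟩
      + 1 / 200 * 1ℚ                              ≡⟨ ℚ.*-identityʳ (+ 1 / 200) ⟩
      + 1 / 200                                   ∎
      where
      open ≤-Reasoning
      S : ℚ
      S = sum (λ i → bit (agree (not b) (C i)))
      scale : ∀ {s N L} → s ≤ ι N → 400 ℕ.* N ℕ.≤ L → + 400 / 1 * s ≤ ι L
      scale {s} {N} {L} s≤N N≤L = ℚ.≤-trans (ℚ.*-monoˡ-≤-nonNeg (+ 400 / 1) s≤N)
        (subst (_≤ ι L) (trans (ι-* 400 N) (cong (_* ι N) (ι-def 400))) (ι-mono N≤L))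
      few : ∀ b → + 400 / 1 * sum (λ i → bit (agree (not b) (C i))) ≤ ι (momentBound b)
      few false = scale (ℚ.≤-reflexive (sum-concerned j)) few-concerned
      few true  = scale (ℚ.≤-trans (sum-mono λ i → bit≤1 (not (C i))) (ℚ.≤-reflexive (trans (sum-const n 1ℚ) (ℚ.*-identityʳ (ι n))))) many-queries

    wrong-hits : ∑ (λ i → const (wrongBit i) *ᴿ hits i) ≼ const (+ 1 / 200)
    wrong-hits = ≼-trans (≼-∑ {x = λ i → const (wrongBit i) *ᴿ hits i} {y = λ i → const (wrongBit i * (+ 2 / 1 * share c))}
        λ i → bit-≼ (agree (not c) (C i)) {hits i} (0≤* (0≤/ 2 1) 0≤share) λ a → wrong-hit i (agree⇒≡ (not c) (C i) a))
      (≼-trans (≼-reflexive λ t → sym (Sum.*-distribʳ-sum (+ 2 / 1 * share c) wrongBit)) (≼-pointwise λ t → wrong-share c refl))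

    -- The three events are disjoint. An output with an item other than that of its position counts
    -- as an answer but as no hit, so wrong answers are bounded through the complement instead of by
    -- the wrong hits directly.
    right-or-fail : ∀ o → bit (answers (not c) j o) + sum (λ i → rightBit i * is (just (i , σ x j i)) o) + is nothing o ≤ 1ℚ
    right-or-fail nothing = ℚ.≤-reflexive (trans (cong (λ z → 0ℚ + z + 1ℚ)
      (trans (Sum.sum-cong-≗ λ i → ℚ.*-zeroʳ (rightBit i)) (Sum.sum-replicate-zero n))) refl)
    right-or-fail o@(just (i , v)) = begin
      wrongBit i + sum (λ i′ → rightBit i′ * is (just (i′ , σ x j i′)) o) + 0ℚ
        ≡⟨ ℚ.+-identityʳ _ ⟩
      wrongBit i + sum (λ i′ → rightBit i′ * is (just (i′ , σ x j i′)) o)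
        ≤⟨ ℚ.+-monoʳ-≤ (wrongBit i) (sum-mono at) ⟩
      wrongBit i + sum (λ i′ → rightBit i * bit (same i i′))
        ≡⟨ cong (λ z → wrongBit i + z) (trans (sym (Sum.*-distribˡ-sum (rightBit i) (λ i′ → bit (same i i′))))
             (trans (cong (λ z → rightBit i * z) (sum-same i)) (ℚ.*-identityʳ (rightBit i)))) ⟩
      wrongBit i + rightBit i
        ≡⟨ trans (ℚ.+-comm (wrongBit i) (rightBit i)) (bit-agree c (C i)) ⟩
      1ℚ ∎
      where
      open ≤-Reasoning
      at : ∀ i′ → rightBit i′ * is (just (i′ , σ x j i′)) o ≤ rightBit i * bit (same i i′)
      at i′ with _≟ₒ_ M o (just (i′ , σ x j i′))
      ... | yes refl = ℚ.≤-reflexive (cong (λ b → rightBit i * bit b) (sym (same-refl i)))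
      ... | no _     = subst (_≤ rightBit i * bit (same i i′)) (sym (ℚ.*-zeroʳ (rightBit i′))) (0≤* (0≤bit (agree c (C i))) (0≤bit (same i i′)))

    right-or-fail-≼ : probability (not c) +ᴿ ∑ (λ i → const (rightBit i) *ᴿ hits i) +ᴿ fail ≼ const 1ℚ
    right-or-fail-≼ = ≼-trans (≼-reflexive λ t → sym (expand t))
      (≼-trans (mono E {φ} λ o → nonneg-const (0≤- (right-or-fail o))) (P1≼1 E))
      where
      φ₁ φ₂ φ₃ φ : Output → Seq
      φ₁ o = const (bit (answers (not c) j o))
      φ₂ o = ∑ λ i → const (rightBit i) *ᴿ const (is (just (i , σ x j i)) o)
      φ₃ o = const (is nothing o)
      φ o = φ₁ o +ᴿ φ₂ o +ᴿ φ₃ o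
      expand : ∀ t → run x j φ t ≡ probability (not c) t + sum (λ i → rightBit i * hits i t) + fail t
      expand t = trans (+-homo E (λ o → φ₁ o +ᴿ φ₂ o) φ₃ t) (cong₂ _+_
        (trans (+-homo E φ₁ φ₂ t) (cong (λ z → probability (not c) t + z)
          (trans (sum-homo E (λ i o → const (rightBit i) *ᴿ const (is (just (i , σ x j i)) o)) t)
            (Sum.sum-cong-≗ λ i → trans (*-homo E (const (rightBit i)) (λ o → const (is (just (i , σ x j i)) o)) t)
              (cong (λ z → rightBit i * z) (sym (Pr≡run x j (just (i , σ x j i)) t)))))))
        (sym (Pr≡run x j nothing t)))

    -- In the limit, wrong answers, right hits and failures have total at most 1, while right hits,
    -- wrong hits and failures have total 1. So wrong answers are no likelier than wrong hits.
    wrong-answer : probability (not c) ≼ const (+ 1 / 200)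
    wrong-answer = ≼-intro λ e 0<e → let d = + 1 / 3 * e ; 0<d = 0<* (0<1/suc 2) 0<e in
      ∀∞-map₂ (λ { t (a , b) w → ≤-by _ (0≤+ (0≤+ (0≤- a) (0≤- b)) (0≤- w))
          (trans (cong (λ h → probability (not c) t + (1ℚ + + 1 / 3 * e - (probability (not c) t + sum (λ i → rightBit i * hits i t) + fail t)
                     + (fail t + h + + 1 / 3 * e - 1ℚ) + (+ 1 / 200 + + 1 / 3 * e - sum (λ i → wrongBit i * hits i t)))) (split t))
            (solve 5 (λ X R f W e → X :+ (con 1ℚ :+ con (+ 1 / 3) :* e :- (X :+ R :+ f) :+ (f :+ (R :+ W) :+ con (+ 1 / 3) :* e :- con 1ℚ)
                 :+ (con (+ 1 / 200) :+ con (+ 1 / 3) :* e :- W)) := con (+ 1 / 200) :+ e)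
              refl (probability (not c) t) (sum (λ i → rightBit i * hits i t)) (fail t) (sum (λ i → wrongBit i * hits i t)) e)) })
        (∀∞-× (within right-or-fail-≼ d 0<d) (within 1≼fail+hits d 0<d))
        (within wrong-hits d 0<d)
      where
      split : ∀ t → sum (λ i → hits i t) ≡ sum (λ i → rightBit i * hits i t) + sum (λ i → wrongBit i * hits i t)
      split t = trans (Sum.sum-cong-≗ λ i → trans (sym (ℚ.*-identityˡ (hits i t)))
          (trans (cong (_* hits i t) (sym (bit-agree c (C i)))) (ℚ.*-distribʳ-+ (hits i t) (rightBit i) (wrongBit i))))
        (Sum.∑-distrib-+ (λ i → rightBit i * hits i t) (λ i → wrongBit i * hits i t))

    answers-or-fail : ∀ o → bit (answers c j o) + bit (answers (not c) j o) + is nothing o ≡ 1ℚ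
    answers-or-fail nothing        = refl
    answers-or-fail (just (i , v)) = trans (ℚ.+-identityʳ _) (bit-agree c (C i))

    -- What remains after failure and wrong answers: 1 - 49/100 - 1/200.
    right-answer : const (+ 101 / 200) ≼ probability c
    right-answer = ≼-intro λ e 0<e → let d = + 1 / 3 * e ; 0<d = 0<* (0<1/suc 2) 0<e in
      ∀∞-map₂ (λ { t (a , b) w → ≤-by _ (0≤+ (0≤+ (0≤- a) (0≤- b)) (0≤- w))
          (trans (cong (λ h → + 101 / 200 + (h + + 1 / 3 * e - 1ℚ + (+ 49 / 100 + + 1 / 3 * e - fail t) + (+ 1 / 200 + + 1 / 3 * e - probability (not c) t))) (expand t))
            (solve 4 (λ Y X f e → con (+ 101 / 200) :+ (Y :+ X :+ f :+ con (+ 1 / 3) :* e :- con 1ℚ :+ (con (+ 49 / 100) :+ con (+ 1 / 3) :* e :- f)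
                 :+ (con (+ 1 / 200) :+ con (+ 1 / 3) :* e :- X)) := Y :+ e)
              refl (probability c t) (probability (not c) t) (fail t) e)) })
        (∀∞-× (within (1≼P1 E) d 0<d) (within fail≼ d 0<d))
        (within wrong-answer d 0<d)
      where
      φ₁ φ₂ φ₃ : Output → Seq
      φ₁ o = const (bit (answers c j o))
      φ₂ o = const (bit (answers (not c) j o))
      φ₃ o = const (is nothing o)
      expand : ∀ t → run x j (λ _ → const 1ℚ) t ≡ probability c t + probability (not c) t + fail t
      expand t = trans (congᴱ E {λ _ → const 1ℚ} {λ o → φ₁ o +ᴿ φ₂ o +ᴿ φ₃ o} t (λ o → sym (answers-or-fail o)))
        (trans (+-homo E (λ o → φ₁ o +ᴿ φ₂ o) φ₃ t)
          (cong₂ _+_ (+-homo E φ₁ φ₂ t) (sym (Pr≡run x j nothing t))))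

  space-bound : .{{_ : ℕ.NonZero κ}} → κ ℕ.≤ OnePassAlgorithm.space A F
  space-bound = index-bound store store-isExpectation answerProbability answer-nonneg answer-≼1 right-answer wrong-answer

-- Assembling the linear bound

-- The universe has n (k + 1) items, and k + 1 ≤ n because every block and the set of queries are
-- nonempty.
space-lower-bound : ∀ {n} κ r m K k₀ → .{{NonZero κ}} → .{{NonZero K}} → K ^ suc k₀ ≤ℕ r → NonZero r → NonZero m →
  n ≡ 10 ℕ.* κ ℕ.* r ℕ.+ m →
  400 ℕ.* (m ℕ.+ r) ≤ℕ 10 ℕ.* κ ℕ.* r ℕ.+ m → 400 ℕ.* (10 ℕ.* κ ℕ.* r ℕ.+ m) ≤ℕ m ℕ.* K →
  (p ε : Seq) → ∀∞ (λ t → 1/suc k₀ ≤ p t) → ε <ᴿ const (+ 9 / 10) →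
  (A : OnePassAlgorithm n) → IsSampler ε (const (+ 49 / 100)) p A →
  Σ[ u ∈ ℕ ] Σ[ F ∈ Similarity u ] (u ≤ℕ n ^ 2 × κ ≤ℕ OnePassAlgorithm.space A F)
space-lower-bound κ r m K k₀ K^≤r r≢0 m≢0 refl few many p ε 1/k₀≤p ε< A sampler =
  n ℕ.* suc k , Instance.F k r m ,
  subst (n ℕ.* suc k ≤ℕ_) (cong (n ℕ.*_) (sym (ℕ.*-identityʳ n))) (ℕ.*-monoʳ-≤ n k<n) ,
  Protocol.space-bound κ r m K k₀ K^≤r few many p ε 1/k₀≤p ε< A sampler
  where
  k n : ℕ
  k = 10 ℕ.* κ
  n = k ℕ.* r ℕ.+ m

  k<n : suc k ≤ℕ n
  k<n = subst (_≤ℕ n) (ℕ.+-comm k 1) (ℕ.+-mono-≤ (ℕ.m≤m*n k r {{r≢0}}) (ℕ.>-nonZero⁻¹ m {{m≢0}}))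

  instance
    n≢0 : NonZero n
    n≢0 = ℕ.>-nonZero (ℕ.≤-trans (ℕ.s≤s ℕ.z≤n) k<n)

    mK≢0 : NonZero (m ℕ.* K)
    mK≢0 = ℕ.m*n≢0 m K {{m≢0}}

1/D*n≤ : ∀ {n κ s} D .{{_ : NonZero D}} → n ≤ℕ κ ℕ.* D → κ ≤ℕ s → + 1 / D * (+ n / 1) ≤ + s / 1
1/D*n≤ {n} {κ} {s} D n≤ κ≤s = subst₂ (λ a b → + 1 / D * a ≤ b) (ι-def n) (ι-def s) (begin
  + 1 / D * ι n           ≤⟨ ℚ.*-monoˡ-≤-nonNeg (+ 1 / D) {{ℚ.normalize-nonNeg 1 D}} (ι-mono n≤) ⟩
  + 1 / D * ι (κ ℕ.* D)   ≡⟨ cong (λ z → + 1 / D * z) (trans (ι-* κ D) (ℚ.*-comm (ι κ) (ι D))) ⟩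
  + 1 / D * (ι D * ι κ)   ≡⟨ ℚ.*-assoc (+ 1 / D) (ι D) (ι κ) ⟨
  + 1 / D * ι D * ι κ     ≡⟨ cong (_* ι κ) (trans (/-*-ι 1 D) (ι-def 1)) ⟩
  1ℚ * ι κ                ≡⟨ ℚ.*-identityˡ (ι κ) ⟩
  ι κ                     ≤⟨ ι-mono κ≤s ⟩
  ι s                     ∎)
  where open ℚ.≤-Reasoning

-- Both c = 1 / D and n₀ depend on p only through r. The numbers `K`, `r` and `D` are variables
-- here; their large values are supplied only at the end.
linear-space : ∀ K .{{_ : NonZero K}} → 800800 ≤ℕ K → ∀ k₀ r .{{_ : NonZero r}} → K ^ suc k₀ ≤ℕ r →
  ∀ D .{{_ : NonZero D}} → 2002 ℕ.* r ≡ D → (p : ℝ) → ∀∞ (λ t → 1/suc k₀ ≤ seq p t) →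
  Σ[ c ∈ ℚ ] Σ[ n₀ ∈ ℕ ] (0ℚ < c ×
    ((ε : ℝ) → const 0ℚ <ᴿ seq ε → seq ε <ᴿ const (+ 9 / 10) →
     (n : ℕ) → n ≥ n₀ →
     (A : OnePassAlgorithm n) → IsSampler (seq ε) (const (+ 49 / 100)) (seq p) A →
     Σ[ u ∈ ℕ ] Σ[ F ∈ Similarity u ] (u ≤ℕ n ^ 2 × c * (+ n / 1) ≤ + OnePassAlgorithm.space A F / 1)))
linear-space K K≥ k₀ r K^≤r D 2002r≡D p 1/k₀≤p =
  + 1 / D , 1000 ℕ.* (1001 ℕ.* r) , ℚ.positive⁻¹ (+ 1 / D) {{ℚ.normalize-pos 1 D}} , λ ε _ ε< n n≥ A sampler →
    let κ , m , κ≢0 , m≢0 , n≡ , few , many , n≤ = sizes r n n≥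
        u , F , u≤ , κ≤ = space-lower-bound κ r m K k₀ {{κ≢0}} K^≤r (ℕ.>-nonZero (ℕ.>-nonZero⁻¹ r)) m≢0 n≡ few (many K≥) (seq p) (seq ε) 1/k₀≤p ε< A sampler
    in u , F , u≤ , 1/D*n≤ D (subst (λ d → n ≤ℕ κ ℕ.* d) 2002r≡D n≤) κ≤

theorem20 : (p : ℝ) → const 0ℚ <ᴿ seq p →
    Σ[ c ∈ ℚ ] Σ[ n₀ ∈ ℕ ] (0ℚ < c ×
    ((ε : ℝ) → const 0ℚ <ᴿ seq ε → seq ε <ᴿ const (+ 9 / 10) →
    (n : ℕ) → n ≥ n₀ →
    (A : OnePassAlgorithm n) → IsSampler (seq ε) (const (+ 49 / 100)) (seq p) A →
    Σ[ u ∈ ℕ ] Σ[ F ∈ Similarity u ] (u ≤ℕ n ^ 2 × c * (+ n / 1) ≤ + OnePassAlgorithm.space A F / 1)))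
theorem20 p (k₀ , N , 1/k₀≤p) =
  linear-space 800800 ℕ.≤-refl k₀ r {{r≢0}} ℕ.≤-refl (2002 ℕ.* r) {{ℕ.m*n≢0 2002 r {{_}} {{r≢0}}}} refl p
    (N , λ t N≤t → subst (_≤ seq p t) (ℚ.+-identityˡ (1/suc k₀)) (1/k₀≤p t N≤t))
  where
  -- The positivity of p provides k₀ with p ≥ 1 / (k₀ + 1) eventually, so the p-th power of r is at
  -- least 800800 = 400 * 2002, the value needed for K.
  r : ℕ
  r = 800800 ^ suc k₀
  r≢0 : NonZero r
  r≢0 = ℕ.m^n≢0 800800 (suc k₀)
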